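{- Let $k\geq 2$ and $t\geq r\geq 3$ be integers. Then for all $n$ large enough the following hold. (i) Every $n$-vertex graph $G$ containing no $t+1$ pairwise vertex-disjoint cycles of length $2k$ satisfies $$k_r(G)\leq \sum_{i=0}^{r}\binom{t}{r-i}\,\mathrm{ex}(n-t,K_i,C_{2k}).$$ (ii) There exists an $n$-vertex graph $G$ containing no $t+1$ pairwise vertex-disjoint cycles of length $2k$ such that $$k_r(G)\geq \binom{t}{r}+\binom{t}{r-1}(n-t)+\max_{2\leq s\leq r}\left\{\binom{t}{r-s}\,\mathrm{ex}(n-t,K_s,C_{2k})\right\}.$$
   Context: $k_r(G)$ denotes the number of copies of the complete graph $K_r$ in $G$. For graphs $T$ and $F$, $\mathrm{ex}(n,T,F)$ is the maximum number of copies of $T$ in an $n$-vertex graph containing no copy of $F$ as a subgraph; by convention $\mathrm{ex}(n,K_0,F)=1$, $\mathrm{ex}(n,K_1,F)=n$, and $\mathrm{ex}(n,K_2,F)=\mathrm{ex}(n,F)$ is the usual Turán number (maximum number of edges). $C_{2k}$ is the cycle of length $2k$. -}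

module Defs where

open import Data.Nat using (ℕ; zero; suc; _+_; _*_; _∸_; _≤_; _⊔_; s≤s; _<?_) renaming (_≟_ to _≟ℕ_)
open import Data.Nat.Combinatorics using (_C_)
open import Data.Bool using (Bool; true; false; _∧_; _∨_; not; T?)
open import Data.Fin using (Fin; _≟_; toℕ; fromℕ<) renaming (zero to fzero)
open import Data.Fin.Subset using (Subset; ∣_∣)
open import Data.Vec using (Vec; []; _∷_; lookup)
open import Data.List using (List; []; _∷_; _++_; map; filter; length; allFin; upTo; applyUpTo; foldr)
open import Data.Nat.ListAction using (sum)
open import Data.Product using (Σ; _×_; ∃; _,_)
open import Relation.Binary.PropositionalEquality using (_≡_)
open import Relation.Nullary using (¬_; yes; no)
open import Relation.Nullary.Decidable using (does)

record Graph (n : ℕ) : Set where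
  field
    adj    : Fin n → Fin n → Bool
    sym    : ∀ i j → adj i j ≡ adj j i
    irrefl : ∀ i → adj i i ≡ false
open Graph public

allSubsets : (n : ℕ) → List (Subset n)
allSubsets zero    = [] ∷ []
allSubsets (suc n) = map (true ∷_) (allSubsets n) ++ map (false ∷_) (allSubsets n)

allB : {A : Set} → (A → Bool) → List A → Bool
allB p = foldr (λ x b → p x ∧ b) true

isClique : {n : ℕ} → Graph n → Subset n → Bool
isClique {n} G S =
  allB (λ i → allB (λ j → not (lookup S i ∧ lookup S j) ∨ does (i ≟ j) ∨ adj G i j)
                 (allFin n))
      (allFin n)

-- k_r(G): number of copies of K_r in G = number of r-element vertex sets
-- spanning a clique (k_0(G) = 1, k_1(G) = n, k_2(G) = e(G)).
kr : {n : ℕ} → ℕ → Graph n → ℕ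
kr {n} r G =
  length (filter (λ S → T? (isClique G S ∧ does (∣ S ∣ ≟ℕ r))) (allSubsets n))

nextMod : {m : ℕ} → Fin m → Fin m
nextMod {suc m} i with suc (toℕ i) <? suc m
... | yes p = fromℕ< p
... | no _  = fzero

-- G contains t pairwise vertex-disjoint cycles of length len:
-- an injective map (a , j) ↦ c a j, where each c a is a closed walk of length len
-- (injectivity of the joint map makes each c a a cycle and the cycles pairwise disjoint).
HasDisjointCycles : {n : ℕ} → (t len : ℕ) → Graph n → Set
HasDisjointCycles {n} t len G =
  Σ (Fin t → Fin len → Fin n) λ c →
    (∀ a b i j → c a i ≡ c b j → (a ≡ b) × (i ≡ j)) ×
    (∀ a i → adj G (c a i) (c a (nextMod i)) ≡ true)

HasCycle : {n : ℕ} → (len : ℕ) → Graph n → Set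
HasCycle len G = HasDisjointCycles 1 len G

IsEx : (n i len m : ℕ) → Set
IsEx n i len m =
  (Σ (Graph n) λ G → ¬ HasCycle len G × kr i G ≡ m) ×
  (∀ (G : Graph n) → ¬ HasCycle len G → kr i G ≤ m)

sumTo : ℕ → (ℕ → ℕ) → ℕ
sumTo r f = sum (map f (upTo (suc r)))

max2To : ℕ → (ℕ → ℕ) → ℕ
max2To r f = foldr _⊔_ 0 (map f (applyUpTo (λ i → 2 + i) (r ∸ 1)))

{-# OPTIONS --safe #-}

-- Idea of the upper bound. Call a vertex v heavy if no bounded set of vertices meets all 2k-cycles
-- through v. A family of disjoint 2k-cycles avoiding a heavy v can be enlarged by a cycle through v,
-- so G has at most t heavy vertices, and if it has t of them then the rest is C_2k-free and the
-- bound follows by distributing the vertices of a clique. Otherwise h < t vertices H are removed and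
-- every other vertex v is light: up to a bounded set its neighbourhood has no path on 2k-1 vertices,
-- hence is degenerate, so v lies in only O(n) cliques. A bounded set hits all 2k-cycles of G - H, so
-- the count is at most the desired sum with h in place of t, plus O(n); since r >= 3 and t >= r,
-- passing from h to t gains at least one term ex(n-t, K_2, C_2k), which is superlinear.
--
-- Superlinearity comes from a greedy construction: edges are added between vertices of degree
-- less than D at distance at least 2k, which only stops when boundedly many such vertices remain.
--
-- For the lower bound, K_t is joined to an extremal C_2k-free graph for the maximising s.

module Submission where

open import Defs
open import Data.Nat using (ℕ; zero; suc; pred; _+_; _*_; _∸_; _^_; _≤_; _<_; _≥_; _⊔_; z≤n; s≤s; _≤?_; _<?_) renaming (_≟_ to _≟ℕ_)
open import Data.Nat.Properties hiding (suc-injective; _≟_)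
open import Data.Nat.Combinatorics using (_C_; nCk+nC[k+1]≡[n+1]C[k+1])
open import Data.Nat.DivMod using (_%_; %-distribˡ-+; m%n%n≡m%n; [m+n]%n≡m%n; m<n⇒m%n≡m; n%n≡0)
open import Data.Nat.ListAction using (sum)
open import Data.Nat.Tactic.RingSolver using (solve-∀)
open import Data.Bool using (Bool; true; false; _∧_; _∨_; not; T; T?; if_then_else_) renaming (_≟_ to _≟ᵇ_)
open import Data.Bool.Properties using (T-≡; T-∧; ∧-conicalˡ; ∧-conicalʳ; ∧-comm; ∨-comm; ∨-zeroʳ)
open import Data.Fin using (Fin; zero; suc; _≟_; toℕ; punchIn)
open import Data.Fin.Properties using (suc-injective; any?; punchInᵢ≢i; punchIn-injective; toℕ-fromℕ<; toℕ-injective; toℕ<n)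
open import Data.Fin.Subset using (Subset; ∣_∣)
import Data.Vec as Vec
open import Data.List using (List; []; _∷_; _++_; map; filter; length; allFin; tabulate; applyUpTo; foldr; lookup; concat; concatMap; replicate; take; drop)
open import Data.List.Properties using (filter-++; filter-≐; filter-none; filter-accept; filter-reject; filter-all; length-++; length-map; length-filter; length-tabulate; length-take; length-drop; map-tabulate; map-applyUpTo; tabulate-lookup; take++drop≡id; ++-assoc)
open import Data.List.Relation.Unary.All as All using (All; []; _∷_)
open import Data.List.Relation.Unary.Any as Any using (here; there)
open import Data.List.Relation.Unary.AllPairs using ([]; _∷_)
open import Data.List.Relation.Unary.Linked using (Linked; []; [-]; _∷_)
open import Data.List.Relation.Unary.Unique.Propositional using (Unique)
open import Data.List.Relation.Unary.Unique.Propositional.Properties using (allFin⁺; drop⁺) renaming (filter⁺ to Unique-filter⁺)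
open import Data.List.Relation.Binary.Permutation.Propositional using (_↭_; refl; prep; swap; trans; ↭-sym; ↭-trans; ↭-refl; ↭-reflexive; ↭⇒↭ₛ)
open import Data.List.Relation.Binary.Permutation.Propositional.Properties using (filter-↭; ↭-length; shift; ∈-resp-↭; ++⁺ˡ)
import Data.List.Relation.Binary.Permutation.Setoid.Properties as Permₛ
open import Data.List.Relation.Binary.Sublist.Propositional using (_⊆_; []; _∷_; _∷ʳ_; ⊆-refl; ⊆-trans)
open import Data.List.Relation.Binary.Sublist.Propositional.Properties using (filter-⊆; filter⁺; length-mono-≤; drop-⊆; Any-resp-⊆)
open import Data.List.Membership.Propositional using (_∈_; _∉_; find)
open import Data.List.Membership.Propositional.Properties using (∈-allFin; ∈-∃++; ∈-map⁺; ∈-applyUpTo⁻; ∈-filter⁻; ∈-concatMap⁺; ∈-concatMap⁻; ∈-++⁺ˡ; ∈-++⁺ʳ; ∈-++⁻; ∈-lookup; ∈-tabulate⁺; ∈-tabulate⁻)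
import Data.List.Membership.DecPropositional as DecMembership
open import Data.Product using (Σ; _×_; _,_; proj₁; proj₂)
open import Data.Sum using (_⊎_; inj₁; inj₂)
open import Data.Empty using (⊥; ⊥-elim)
open import Data.Unit using (tt)
open import Function using (_∘_; id; Equivalence)
open import Relation.Binary.PropositionalEquality as ≡ using (_≡_; _≢_; refl; cong; cong₂; subst)
open import Relation.Nullary using (¬_; yes; no; does; contradiction; ¬?)
open import Relation.Nullary.Decidable using (map′; dec-true; decidable-stable)
open import Relation.Unary using (Pred; Decidable)

-- Clique counts over vertex lists.

nbrs : {A : Set} → (A → A → Bool) → A → List A → List A
nbrs e x = filter (T? ∘ e x)

module _ {A : Set} {p q} {P : Pred A p} {Q : Pred A q} (P? : Decidable P) (Q? : Decidable Q) where

  filter-comm : ∀ xs → filter P? (filter Q? xs) ≡ filter Q? (filter P? xs)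
  filter-comm [] = refl
  filter-comm (x ∷ xs) with does (P? x) in p | does (Q? x) in q
  ... | true  | true  rewrite p | q = cong (x ∷_) (filter-comm xs)
  ... | true  | false rewrite q = filter-comm xs
  ... | false | true  rewrite p = filter-comm xs
  ... | false | false = filter-comm xs

filter-map : ∀ {A B : Set} {p} {P : Pred B p} (P? : Decidable P) (f : A → B) xs →
  filter P? (map f xs) ≡ map f (filter (P? ∘ f) xs)
filter-map P? f [] = refl
filter-map P? f (x ∷ xs) with does (P? (f x))
... | true  = cong (f x ∷_) (filter-map P? f xs)
... | false = filter-map P? f xs

-- Each clique is counted at its earliest entry in the list, so that counts can be bounded by
-- induction over lists. For symmetric `e` the order is irrelevant by `K-↭`.
K : {A : Set} → (A → A → Bool) → ℕ → List A → ℕ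
K e zero    _        = 1
K e (suc r) []       = 0
K e (suc r) (x ∷ xs) = K e (suc r) xs + K e r (nbrs e x xs)

module _ {A : Set} (e : A → A → Bool) where

  K-mono : ∀ r {xs ys} → xs ⊆ ys → K e r xs ≤ K e r ys
  K-mono zero    _          = ≤-refl
  K-mono (suc r) []         = z≤n
  K-mono (suc r) (y ∷ʳ s)   = m≤n⇒m≤n+o _ (K-mono (suc r) s)
  K-mono (suc r) {x ∷ _} (refl ∷ s) =
    +-mono-≤ (K-mono (suc r) s) (K-mono r (filter⁺ (T? ∘ e x) (T? ∘ e x) (λ { refl → id }) s))

  K-nbrs : ∀ r x xs → K e r (nbrs e x xs) ≤ K e r xs
  K-nbrs r x xs = K-mono r (filter-⊆ (T? ∘ e x) xs)

  K-one : ∀ xs → K e 1 xs ≡ length xs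
  K-one []       = refl
  K-one (x ∷ xs) = ≡.trans (+-comm (K e 1 xs) 1) (cong suc (K-one xs))

  K≤2^length : ∀ r xs → K e r xs ≤ 2 ^ length xs
  K≤2^length zero    xs       = m^n>0 2 (length xs)
  K≤2^length (suc r) []       = z≤n
  K≤2^length (suc r) (x ∷ xs) = +-mono-≤ (K≤2^length (suc r) xs)
    (≤-trans (K-nbrs r x xs) (≤-trans (K≤2^length r xs) (≤-reflexive (≡.sym (+-identityʳ _)))))

  module _ (e-sym : ∀ x y → e x y ≡ e y x) where

    private
      K-∷-if : ∀ r x y zs → K e (suc r) (nbrs e x (y ∷ zs)) ≡
        K e (suc r) (nbrs e x zs) + (if e x y then K e r (nbrs e y (nbrs e x zs)) else 0)
      K-∷-if r x y zs with e x y
      ... | true  = refl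
      ... | false = ≡.sym (+-identityʳ _)

      -- The terms are the cliques with neither of `x` and `y`, with `x` only, with `y` only, and
      -- with both. Up to the order of two filters and of the arguments of `e` this is symmetric in
      -- `x` and `y`, which yields `K-swap`.
      K-∷∷ : ∀ r x y zs → K e (suc (suc r)) (x ∷ y ∷ zs) ≡
        (K e (suc (suc r)) zs + (K e (suc r) (nbrs e x zs) + K e (suc r) (nbrs e y zs)))
        + (if e x y then K e r (nbrs e y (nbrs e x zs)) else 0)
      K-∷∷ r x y zs = begin
        (a + c) + K e (suc r) (nbrs e x (y ∷ zs)) ≡⟨ cong ((a + c) +_) (K-∷-if r x y zs) ⟩
        (a + c) + (b + d)                         ≡⟨ +-assoc (a + c) b d ⟨
        ((a + c) + b) + d                         ≡⟨ cong (_+ d) (+-assoc a c b) ⟩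
        (a + (c + b)) + d                         ≡⟨ cong (λ z → (a + z) + d) (+-comm c b) ⟩
        (a + (b + c)) + d                         ∎
        where
        open ≡.≡-Reasoning
        a = K e (suc (suc r)) zs
        b = K e (suc r) (nbrs e x zs)
        c = K e (suc r) (nbrs e y zs)
        d = if e x y then K e r (nbrs e y (nbrs e x zs)) else 0

      K-swap : ∀ r x y zs → K e r (x ∷ y ∷ zs) ≡ K e r (y ∷ x ∷ zs)
      K-swap zero          x y zs = refl
      K-swap (suc zero)    x y zs = refl
      K-swap (suc (suc r)) x y zs
        rewrite K-∷∷ r x y zs | K-∷∷ r y x zs | e-sym x y | filter-comm (T? ∘ e y) (T? ∘ e x) zs
              | +-comm (K e (suc r) (nbrs e x zs)) (K e (suc r) (nbrs e y zs)) = refl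

    K-↭ : ∀ r {xs ys} → xs ↭ ys → K e r xs ≡ K e r ys
    K-↭ zero    _           = refl
    K-↭ (suc r) refl        = refl
    K-↭ (suc r) (prep x s)  = cong₂ _+_ (K-↭ (suc r) s) (K-↭ r (filter-↭ (T? ∘ e x) s))
    K-↭ (suc r) (swap {ys = zs} x y s) = ≡.trans
      (cong₂ _+_ (cong₂ _+_ (K-↭ (suc r) s) (K-↭ r (filter-↭ (T? ∘ e y) s)))
                 (K-↭ r (filter-↭ (T? ∘ e x) (prep y s))))
      (K-swap (suc r) x y zs)
    K-↭ (suc r) (trans s s′) = ≡.trans (K-↭ (suc r) s) (K-↭ (suc r) s′)

K-map : ∀ {A B : Set} (e : B → B → Bool) (f : A → B) r xs →
  K e r (map f xs) ≡ K (λ x y → e (f x) (f y)) r xs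
K-map e f zero    xs       = refl
K-map e f (suc r) []       = refl
K-map e f (suc r) (x ∷ xs) = cong₂ _+_ (K-map e f (suc r) xs)
  (≡.trans (cong (K e r) (filter-map (T? ∘ e (f x)) f xs)) (K-map e f r _))

K-mono-adj : ∀ {A : Set} (e e′ : A → A → Bool) → (∀ x y → T (e x y) → T (e′ x y)) →
  ∀ r xs → K e r xs ≤ K e′ r xs
K-mono-adj e e′ sub zero    xs       = ≤-refl
K-mono-adj e e′ sub (suc r) []       = z≤n
K-mono-adj e e′ sub (suc r) (x ∷ xs) = +-mono-≤ (K-mono-adj e e′ sub (suc r) xs)
  (≤-trans (K-mono-adj e e′ sub r (nbrs e x xs))
           (K-mono e′ r (filter⁺ (T? ∘ e x) (T? ∘ e′ x) (λ { refl → sub x _ }) (⊆-refl {x = xs}))))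

-- Agreement with the count over vertex subsets.

IsCliqueIn : ∀ {n} → Graph n → ℕ → (Fin n → Bool) → Subset n → Set
IsCliqueIn G r M S =
  (∀ i j → Vec.lookup S i ≡ true → Vec.lookup S j ≡ true → i ≢ j → adj G i j ≡ true)
  × ∣ S ∣ ≡ r × (∀ i → Vec.lookup S i ≡ true → M i ≡ true)

pull : ∀ {m n} → (Fin m → Fin n) → Graph n → Graph m
pull f G .adj i j  = adj G (f i) (f j)
pull f G .sym i j  = sym G (f i) (f j)
pull f G .irrefl i = irrefl G (f i)

allFin-suc : ∀ n → allFin (suc n) ≡ zero ∷ map suc (allFin n)
allFin-suc n = cong (zero ∷_) (≡.sym (map-tabulate id suc))

length-allFin : ∀ n → length (allFin n) ≡ n
length-allFin n = length-tabulate id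

filter-filter : ∀ {A : Set} (p q : A → Bool) xs →
  filter (T? ∘ q) (filter (T? ∘ p) xs) ≡ filter (T? ∘ λ x → p x ∧ q x) xs
filter-filter p q [] = refl
filter-filter p q (x ∷ xs) with p x
... | false = filter-filter p q xs
... | true with q x
...   | true  = cong (x ∷_) (filter-filter p q xs)
...   | false = filter-filter p q xs

allB-elim : ∀ {A : Set} (p : A → Bool) xs → allB p xs ≡ true → ∀ {x} → x ∈ xs → p x ≡ true
allB-elim p xs h = All.lookup (go xs h)
  where
  go : ∀ ys → allB p ys ≡ true → All (λ x → p x ≡ true) ys
  go [] _ = []
  go (y ∷ ys) h = ∧-conicalˡ _ _ h ∷ go ys (∧-conicalʳ (p y) _ h)

allB-intro : ∀ {A : Set} (p : A → Bool) xs → (∀ x → p x ≡ true) → allB p xs ≡ true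
allB-intro p [] h = refl
allB-intro p (x ∷ xs) h rewrite h x = allB-intro p xs h

private
  count : ∀ {n} {p} {P : Pred (Subset n) p} → Decidable P → ℕ
  count {n} P? = length (filter P? (allSubsets n))

  count-suc : ∀ {n} {p} {P : Pred (Subset (suc n)) p} (P? : Decidable P) →
    count P? ≡ count (P? ∘ (true Vec.∷_)) + count (P? ∘ (false Vec.∷_))
  count-suc {n} P?
    rewrite filter-++ P? (map (true Vec.∷_) (allSubsets n)) (map (false Vec.∷_) (allSubsets n))
          | length-++ (filter P? (map (true Vec.∷_) (allSubsets n))) {filter P? (map (false Vec.∷_) (allSubsets n))}
          | filter-map P? (true Vec.∷_) (allSubsets n)
          | filter-map P? (false Vec.∷_) (allSubsets n)
          | length-map (true Vec.∷_) (filter (P? ∘ (true Vec.∷_)) (allSubsets n))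
          | length-map (false Vec.∷_) (filter (P? ∘ (false Vec.∷_)) (allSubsets n)) = refl

  count-cong : ∀ {n} {p q} {P : Pred (Subset n) p} {Q : Pred (Subset n) q}
    (P? : Decidable P) (Q? : Decidable Q) → (∀ S → P S → Q S) → (∀ S → Q S → P S) →
    count P? ≡ count Q?
  count-cong {n} P? Q? f g = cong length (filter-≐ P? Q? ((λ {S} → f S) , (λ {S} → g S)) (allSubsets n))

  count-none : ∀ {n} {p} {P : Pred (Subset n) p} (P? : Decidable P) → (∀ S → ¬ P S) → count P? ≡ 0
  count-none {n} P? h = cong length (filter-none P? (All.universal h (allSubsets n)))

  module _ {n : ℕ} (G : Graph (suc n)) where

    G′ : Graph n
    G′ = pull suc G

    false-to : ∀ {r M S} → IsCliqueIn G r M (false Vec.∷ S) → IsCliqueIn G′ r (M ∘ suc) S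
    false-to (c , s , m) = (λ i j p q i≢j → c (suc i) (suc j) p q (i≢j ∘ suc-injective)) , s , m ∘ suc

    false-from : ∀ {r M S} → IsCliqueIn G′ r (M ∘ suc) S → IsCliqueIn G r M (false Vec.∷ S)
    false-from {r} {M} {S} (c , s , m) = c′ , s , m′
      where
      c′ : ∀ i j → Vec.lookup (false Vec.∷ S) i ≡ true → Vec.lookup (false Vec.∷ S) j ≡ true →
        i ≢ j → adj G i j ≡ true
      c′ (suc i) (suc j) p q i≢j = c i j p q (i≢j ∘ cong suc)
      m′ : ∀ i → Vec.lookup (false Vec.∷ S) i ≡ true → M i ≡ true
      m′ (suc i) p = m i p

    true-to : ∀ {r M S} → IsCliqueIn G (suc r) M (true Vec.∷ S) →
      IsCliqueIn G′ r (λ j → M (suc j) ∧ adj G zero (suc j)) S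
    true-to (c , s , m) =
      (λ i j p q i≢j → c (suc i) (suc j) p q (i≢j ∘ suc-injective)) , cong pred s ,
      λ i p → cong₂ _∧_ (m (suc i) p) (c zero (suc i) refl p λ ())

    true-from : ∀ {r M S} → M zero ≡ true → IsCliqueIn G′ r (λ j → M (suc j) ∧ adj G zero (suc j)) S →
      IsCliqueIn G (suc r) M (true Vec.∷ S)
    true-from {r} {M} {S} m0 (c , s , m) = c′ , cong suc s , m′
      where
      c′ : ∀ i j → Vec.lookup (true Vec.∷ S) i ≡ true → Vec.lookup (true Vec.∷ S) j ≡ true →
        i ≢ j → adj G i j ≡ true
      c′ zero    zero    p q i≢j = contradiction refl i≢j
      c′ zero    (suc j) p q i≢j = ∧-conicalʳ (M (suc j)) _ (m j q)
      c′ (suc i) zero    p q i≢j = ≡.trans (sym G (suc i) zero) (∧-conicalʳ (M (suc i)) _ (m i p))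
      c′ (suc i) (suc j) p q i≢j = c i j p q (i≢j ∘ cong suc)
      m′ : ∀ i → Vec.lookup (true Vec.∷ S) i ≡ true → M i ≡ true
      m′ zero    _ = m0
      m′ (suc i) p = ∧-conicalˡ _ _ (m i p)

  -- Subsets are split by whether they contain vertex `zero`. The mask `M` lets the candidates
  -- shrink to the neighbours of `zero` once it is taken. The decision procedure is arbitrary, so
  -- that it can be pulled back along the splitting.
  count≡K : ∀ {n} (G : Graph n) r M (P? : Decidable (IsCliqueIn G r M)) →
    count P? ≡ K (adj G) r (filter (T? ∘ M) (allFin n))
  count≡K {zero} G zero M P? = cong length (filter-accept P? {xs = []} ((λ ()) , refl , λ ()))
  count≡K {zero} G (suc r) M P? = cong length (filter-reject P? {xs = []} λ { (_ , () , _) })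
  count≡K {suc n} G r M P? = ≡.trans (count-suc P?) (≡.trans (step r P?)
    (cong (K (adj G) r ∘ filter (T? ∘ M)) (≡.sym (allFin-suc n))))
    where
    L : List (Fin n)
    L = filter (T? ∘ M ∘ suc) (allFin n)

    tail-filter : filter (T? ∘ M) (map suc (allFin n)) ≡ map suc L
    tail-filter = filter-map (T? ∘ M) suc (allFin n)

    right : ∀ r (P? : Decidable (IsCliqueIn G r M)) → count (P? ∘ (false Vec.∷_)) ≡ K (adj G) r (map suc L)
    right r P? = ≡.trans (count-cong (P? ∘ (false Vec.∷_)) D? (λ _ → false-to G) (λ _ → false-from G))
      (≡.trans (count≡K (G′ G) r (M ∘ suc) D?) (≡.sym (K-map (adj G) suc r L)))
      where
      D? : Decidable (IsCliqueIn (G′ G) r (M ∘ suc))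
      D? S = map′ (false-to G) (false-from G) (P? (false Vec.∷ S))

    step : ∀ r (P? : Decidable (IsCliqueIn G r M)) →
      count (P? ∘ (true Vec.∷_)) + count (P? ∘ (false Vec.∷_))
      ≡ K (adj G) r (filter (T? ∘ M) (zero ∷ map suc (allFin n)))
    step zero P? = cong₂ _+_ (count-none (P? ∘ (true Vec.∷_)) λ { S (_ , () , _) }) (right zero P?)
    step (suc r) P? with M zero in m0
    ... | false rewrite tail-filter =
      cong₂ _+_ (count-none (P? ∘ (true Vec.∷_)) λ S (_ , _ , m) → case-⊥ (≡.trans (≡.sym m0) (m zero refl)))
                (right (suc r) P?)
      where
      case-⊥ : false ≡ true → ⊥
      case-⊥ ()
    ... | true rewrite tail-filter =
      ≡.trans (+-comm (count (P? ∘ (true Vec.∷_))) _) (cong₂ _+_ (right (suc r) P?) left)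
      where
      D? : Decidable (IsCliqueIn (G′ G) r (λ j → M (suc j) ∧ adj G zero (suc j)))
      D? S = map′ (true-to G) (true-from G m0) (P? (true Vec.∷ S))

      left : count (P? ∘ (true Vec.∷_)) ≡ K (adj G) r (nbrs (adj G) zero (map suc L))
      left = begin
        count (P? ∘ (true Vec.∷_))
          ≡⟨ count-cong (P? ∘ (true Vec.∷_)) D? (λ _ → true-to G) (λ _ → true-from G m0) ⟩
        count D?
          ≡⟨ count≡K (G′ G) r _ D? ⟩
        K (adj (G′ G)) r (filter (T? ∘ λ j → M (suc j) ∧ adj G zero (suc j)) (allFin n))
          ≡⟨ cong (K (adj (G′ G)) r) (filter-filter (M ∘ suc) (adj G zero ∘ suc) (allFin n)) ⟨
        K (adj (G′ G)) r (filter (T? ∘ adj G zero ∘ suc) L)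
          ≡⟨ K-map (adj G) suc r _ ⟨
        K (adj G) r (map suc (filter (T? ∘ adj G zero ∘ suc) L))
          ≡⟨ cong (K (adj G) r) (filter-map (T? ∘ adj G zero) suc L) ⟨
        K (adj G) r (nbrs (adj G) zero (map suc L)) ∎
        where open ≡.≡-Reasoning

kr≡K : ∀ {n} r (G : Graph n) → kr r G ≡ K (adj G) r (allFin n)
kr≡K {n} r G = ≡.trans (count-cong (λ S → T? (isClique G S ∧ does (∣ S ∣ ≟ℕ r))) D? to from)
  (≡.trans (count≡K G r (λ _ → true) D?) (cong (K (adj G) r) (filter-all (T? ∘ λ _ → true) (All.universal _ (allFin n)))))
  where
  to : ∀ S → T (isClique G S ∧ does (∣ S ∣ ≟ℕ r)) → IsCliqueIn G r (λ _ → true) S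
  to S h = c , size , λ _ _ → refl
    where
    h′ : T (isClique G S) × T (does (∣ S ∣ ≟ℕ r))
    h′ = Equivalence.to T-∧ h
    size : ∣ S ∣ ≡ r
    size = ≡ᵇ⇒≡ _ _ (proj₂ h′)
    c : ∀ i j → Vec.lookup S i ≡ true → Vec.lookup S j ≡ true → i ≢ j → adj G i j ≡ true
    c i j p q i≢j with allB-elim _ (allFin n) (allB-elim _ (allFin n) (Equivalence.to T-≡ (proj₁ h′)) (∈-allFin i)) (∈-allFin j)
    ... | eq rewrite p | q with i ≟ j
    ...   | yes i≡j = contradiction i≡j i≢j
    ...   | no _    = eq
  from : ∀ S → IsCliqueIn G r (λ _ → true) S → T (isClique G S ∧ does (∣ S ∣ ≟ℕ r))
  from S (c , size , _) = Equivalence.from T-∧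
    (Equivalence.from T-≡ (allB-intro _ (allFin n) λ i → allB-intro _ (allFin n) λ j → b i j) , ≡⇒≡ᵇ _ _ size)
    where
    b : ∀ i j → not (Vec.lookup S i ∧ Vec.lookup S j) ∨ does (i ≟ j) ∨ adj G i j ≡ true
    b i j with Vec.lookup S i in p | Vec.lookup S j in q
    ... | false | _     = refl
    ... | true  | false = refl
    ... | true  | true with i ≟ j
    ...   | yes _ = refl
    ...   | no i≢j = c i j p q i≢j
  D? : Decidable (IsCliqueIn G r (λ _ → true))
  D? S = map′ (to S) (from S) (T? (isClique G S ∧ does (∣ S ∣ ≟ℕ r)))

-- Counting cliques in joins

-- This is the sum over i of C(h, r - i) f(i), unfolded by Pascal's rule: one of `h` fully joined
-- vertices is either left out of the clique or put into it.
joinCount : ℕ → ℕ → (ℕ → ℕ) → ℕ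
joinCount zero    r       f = f r
joinCount (suc h) zero    f = f 0
joinCount (suc h) (suc r) f = joinCount h (suc r) f + joinCount h r f

private
  -- An intermediate form: peeling off the term i = 0 and shifting `f` matches the unfolding of
  -- `sumTo` and lets Pascal's rule act term by term.
  binSum : ℕ → ℕ → (ℕ → ℕ) → ℕ
  binSum h zero    f = (h C 0) * f 0
  binSum h (suc r) f = (h C suc r) * f 0 + binSum h r (f ∘ suc)

  rearrange : ∀ a b x s u → (a + b) * x + (s + u) ≡ b * x + s + (a * x + u)
  rearrange = solve-∀

  binSum-pascal : ∀ h r f → binSum (suc h) (suc r) f ≡ binSum h (suc r) f + binSum h r f
  binSum-pascal h zero f
    rewrite ≡.sym (nCk+nC[k+1]≡[n+1]C[k+1] h 0) = lemma (h C 1) (f 0) (f 1)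
    where
    lemma : ∀ a x y → (1 + a) * x + 1 * y ≡ a * x + 1 * y + 1 * x
    lemma = solve-∀
  binSum-pascal h (suc r) f
    rewrite ≡.sym (nCk+nC[k+1]≡[n+1]C[k+1] h (suc r)) | binSum-pascal h r (f ∘ suc) =
    rearrange (h C suc r) (h C suc (suc r)) (f 0) _ _

  binSum-zero : ∀ r f → binSum 0 r f ≡ f r
  binSum-zero zero    f = +-identityʳ (f 0)
  binSum-zero (suc r) f = binSum-zero r (f ∘ suc)

  binSum≡joinCount : ∀ h r f → binSum h r f ≡ joinCount h r f
  binSum≡joinCount zero    r       f = binSum-zero r f
  binSum≡joinCount (suc h) zero    f = +-identityʳ (f 0)
  binSum≡joinCount (suc h) (suc r) f =
    ≡.trans (binSum-pascal h r f) (cong₂ _+_ (binSum≡joinCount h (suc r) f) (binSum≡joinCount h r f))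

  sumTo-suc : ∀ r g → sumTo (suc r) g ≡ g 0 + sumTo r (g ∘ suc)
  sumTo-suc r g = cong (λ l → g 0 + sum l) (≡.trans (map-applyUpTo suc g (suc r)) (≡.sym (map-applyUpTo id (g ∘ suc) (suc r))))

  sumTo≡binSum : ∀ h r f → sumTo r (λ i → (h C (r ∸ i)) * f i) ≡ binSum h r f
  sumTo≡binSum h zero    f = +-identityʳ _
  sumTo≡binSum h (suc r) f =
    ≡.trans (sumTo-suc r (λ i → (h C (suc r ∸ i)) * f i)) (cong ((h C suc r) * f 0 +_) (sumTo≡binSum h r (f ∘ suc)))

sumTo≡joinCount : ∀ h r f → sumTo r (λ i → (h C (r ∸ i)) * f i) ≡ joinCount h r f
sumTo≡joinCount h r f = ≡.trans (sumTo≡binSum h r f) (binSum≡joinCount h r f)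

-- Disjoint cycles, cones and the lower bound.

cycles-avoiding-zero : ∀ {m} s L (G : Graph (suc m)) (c : Fin s → Fin L → Fin (suc m)) →
  (∀ a b i j → c a i ≡ c b j → (a ≡ b) × (i ≡ j)) →
  (∀ a i → adj G (c a i) (c a (nextMod i)) ≡ true) →
  (∀ a i → c a i ≢ zero) → HasDisjointCycles s L (pull suc G)
cycles-avoiding-zero {m} s L G c inj edge avoid = d , inj′ , edge′
  where
  pred′ : (x : Fin (suc m)) → x ≢ zero → Σ (Fin m) λ y → suc y ≡ x
  pred′ zero    x≢0 = contradiction refl x≢0
  pred′ (suc x) _   = x , refl

  d : Fin s → Fin L → Fin m
  d a i = proj₁ (pred′ (c a i) (avoid a i))

  suc-d : ∀ a i → suc (d a i) ≡ c a i
  suc-d a i = proj₂ (pred′ (c a i) (avoid a i))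

  inj′ : ∀ a b i j → d a i ≡ d b j → (a ≡ b) × (i ≡ j)
  inj′ a b i j eq = inj a b i j (≡.trans (≡.sym (suc-d a i)) (≡.trans (cong suc eq) (suc-d b j)))

  edge′ : ∀ a i → adj G (suc (d a i)) (suc (d a (nextMod i))) ≡ true
  edge′ a i = ≡.trans (cong₂ (adj G) (suc-d a i) (suc-d a (nextMod i))) (edge a i)

-- Of s + 1 disjoint cycles at most one passes through a given vertex.
cycles-delete-zero : ∀ {m} s L (G : Graph (suc m)) →
  HasDisjointCycles (suc s) L G → HasDisjointCycles s L (pull suc G)
cycles-delete-zero s L G (c , inj , edge) with any? (λ a → any? (λ i → c a i ≟ zero))
... | yes (a₀ , i₀ , eq₀) = cycles-avoiding-zero s L G (c ∘ punchIn a₀)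
  (λ a b i j eq → punchIn-injective a₀ a b (proj₁ (inj _ _ i j eq)) , proj₂ (inj _ _ i j eq))
  (edge ∘ punchIn a₀)
  (λ a i eq → punchInᵢ≢i a₀ a (proj₁ (inj _ _ i i₀ (≡.trans eq (≡.sym eq₀)))))
... | no none = cycles-avoiding-zero s L G (c ∘ suc)
  (λ a b i j eq → suc-injective (proj₁ (inj _ _ i j eq)) , proj₂ (inj _ _ i j eq))
  (edge ∘ suc)
  (λ a i eq → none (suc a , i , eq))

cone : ∀ {m} → Graph m → Graph (suc m)
cone G .adj zero    zero    = false
cone G .adj zero    (suc j) = true
cone G .adj (suc i) zero    = true
cone G .adj (suc i) (suc j) = adj G i j
cone G .sym zero    zero    = refl
cone G .sym zero    (suc j) = refl
cone G .sym (suc i) zero    = refl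
cone G .sym (suc i) (suc j) = sym G i j
cone G .irrefl zero    = refl
cone G .irrefl (suc i) = irrefl G i

kr-zero : ∀ {n} (G : Graph n) → kr 0 G ≡ 1
kr-zero G = kr≡K 0 G

kr-one : ∀ {n} (G : Graph n) → kr 1 G ≡ n
kr-one {n} G = ≡.trans (kr≡K 1 G) (≡.trans (K-one (adj G) (allFin n)) (length-tabulate id))

kr-suc : ∀ {m} r (G : Graph (suc m)) →
  kr (suc r) G ≡ kr (suc r) (pull suc G) + K (adj G) r (nbrs (adj G) zero (map suc (allFin m)))
kr-suc {m} r G = begin
  kr (suc r) G
    ≡⟨ kr≡K (suc r) G ⟩
  K (adj G) (suc r) (allFin (suc m))
    ≡⟨ cong (K (adj G) (suc r)) (allFin-suc m) ⟩
  K (adj G) (suc r) (map suc (allFin m)) + rest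
    ≡⟨ cong (_+ rest) (K-map (adj G) suc (suc r) (allFin m)) ⟩
  K (adj (pull suc G)) (suc r) (allFin m) + rest
    ≡⟨ cong (_+ rest) (kr≡K (suc r) (pull suc G)) ⟨
  kr (suc r) (pull suc G) + rest ∎
  where
  open ≡.≡-Reasoning
  rest : ℕ
  rest = K (adj G) r (nbrs (adj G) zero (map suc (allFin m)))

kr-cone : ∀ {m} r (G : Graph m) → kr (suc r) (cone G) ≡ kr (suc r) G + kr r G
kr-cone {m} r G = ≡.trans (kr-suc r (cone G)) (cong (kr (suc r) G +_)
  (≡.trans (cong (K (adj (cone G)) r) (filter-all (T? ∘ adj (cone G) zero) all-adjacent))
  (≡.trans (K-map (adj (cone G)) suc r (allFin m)) (≡.sym (kr≡K r G)))))
  where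
  go : ∀ xs → All (T ∘ adj (cone G) zero) (map suc xs)
  go []       = []
  go (x ∷ xs) = tt ∷ go xs
  all-adjacent : All (T ∘ adj (cone G) zero) (map suc (allFin m))
  all-adjacent = go (allFin m)

cones : ∀ {m} t → Graph m → Graph (t + m)
cones zero    G = G
cones (suc t) G = cone (cones t G)

kr-cones : ∀ {m} t r (G : Graph m) → kr r (cones t G) ≡ joinCount t r (λ i → kr i G)
kr-cones zero    r       G = refl
kr-cones (suc t) zero    G = ≡.trans (kr-zero (cones (suc t) G)) (≡.sym (kr-zero G))
kr-cones (suc t) (suc r) G = ≡.trans (kr-cone r (cones t G)) (cong₂ _+_ (kr-cones t (suc r) G) (kr-cones t r G))

-- Deleting the `t` apexes one at a time destroys at most one cycle each, so `t + 1` disjoint cycles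
-- would leave one inside `G`.
cones-cycles : ∀ {m} t L (G : Graph m) → ¬ HasCycle L G → ¬ HasDisjointCycles (suc t) L (cones t G)
cones-cycles zero    L G no-cycle = no-cycle
cones-cycles (suc t) L G no-cycle = cones-cycles t L G no-cycle ∘ cycles-delete-zero (suc t) L (cones (suc t) G)

∈⇒≤sum : ∀ {x xs} → x ∈ xs → x ≤ sum xs
∈⇒≤sum (here refl) = m≤m+n _ _
∈⇒≤sum {xs = y ∷ _} (there x∈) = m≤n⇒m≤o+n y (∈⇒≤sum x∈)

foldr-⊔-attained : ∀ (f : ℕ → ℕ) x xs → Σ ℕ λ s → s ∈ (x ∷ xs) × foldr _⊔_ 0 (map f (x ∷ xs)) ≡ f s
foldr-⊔-attained f x [] = x , here refl , ⊔-identityʳ (f x)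
foldr-⊔-attained f x (y ∷ ys) with foldr-⊔-attained f y ys | ⊔-sel (f x) (foldr _⊔_ 0 (map f (y ∷ ys)))
... | _            | inj₁ eq = x , here refl , eq
... | s , s∈ , eq′ | inj₂ eq = s , there s∈ , ≡.trans eq eq′

lower-bound : ∀ L t r m → r ≥ 3 → (ex : ℕ → ℕ) → (∀ i → i ≤ r → IsEx m i L (ex i)) →
  Σ (Graph (t + m)) λ G → ¬ HasDisjointCycles (suc t) L G ×
    (t C r) + (t C (r ∸ 1)) * m + max2To r (λ s → (t C (r ∸ s)) * ex s) ≤ kr r G
lower-bound L t r@(suc (suc r-2)) m (s≤s (s≤s _)) ex isEx
  -- The index range 2, ..., r is nonempty, so the maximum is attained at some `s` and the default
  -- value 0 of the fold is harmless.
  with foldr-⊔-attained (λ s → (t C (r ∸ s)) * ex s) 2 (applyUpTo (λ i → suc (suc (suc i))) r-2)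
... | s , s∈ , max≡ with isEx s (s≤r s∈)
  where
  s≤r : ∀ {s} → s ∈ applyUpTo (λ i → 2 + i) (suc r-2) → s ≤ r
  s≤r s∈ with ∈-applyUpTo⁻ (λ i → 2 + i) s∈
  ... | i , s≤s i≤ , refl = s≤s (s≤s i≤)
...   | (H , free , krH) , _ = cones t H , cones-cycles t L H free , bound
  where
  open ≤-Reasoning
  g : ℕ → ℕ
  g i = (t C (r ∸ i)) * kr i H

  term-s : (t C (r ∸ s)) * ex s ≤ sum (map g (applyUpTo (λ i → 2 + i) (suc r-2)))
  term-s = ≤-trans (≤-reflexive (cong ((t C (r ∸ s)) *_) (≡.sym krH))) (∈⇒≤sum (∈-map⁺ g s∈))

  bound : (t C r) + (t C (r ∸ 1)) * m + max2To r (λ s → (t C (r ∸ s)) * ex s) ≤ kr r (cones t H)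
  bound = begin
    (t C r) + (t C (r ∸ 1)) * m + max2To r (λ s → (t C (r ∸ s)) * ex s)
      ≡⟨ cong₂ (λ a b → a + b + max2To r (λ s → (t C (r ∸ s)) * ex s))
           (≡.trans (≡.sym (*-identityʳ (t C r))) (cong ((t C r) *_) (≡.sym (kr-zero H))))
           (cong ((t C (r ∸ 1)) *_) (≡.sym (kr-one H))) ⟩
    g 0 + g 1 + max2To r (λ s → (t C (r ∸ s)) * ex s)
      ≡⟨ cong (g 0 + g 1 +_) max≡ ⟩
    g 0 + g 1 + (t C (r ∸ s)) * ex s
      ≤⟨ +-monoʳ-≤ (g 0 + g 1) term-s ⟩
    g 0 + g 1 + sum (map g (applyUpTo (λ i → 2 + i) (suc r-2)))
      ≡⟨ +-assoc (g 0) (g 1) _ ⟩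
    sumTo r g
      ≡⟨ sumTo≡joinCount t r (λ i → kr i H) ⟩
    joinCount t r (λ i → kr i H)
      ≡⟨ kr-cones t r H ⟨
    kr r (cones t H) ∎

-- Permutations and duplicate-free lists.

module _ {A : Set} where

  ∈⇒↭ : ∀ {x : A} {xs} → x ∈ xs → Σ (List A) λ ys → xs ↭ x ∷ ys
  ∈⇒↭ {x} x∈ with ∈-∃++ x∈
  ... | ys , zs , refl = ys ++ zs , shift x ys zs

  filter-split : ∀ {p} {P : Pred A p} (P? : Decidable P) xs → xs ↭ filter P? xs ++ filter (¬? ∘ P?) xs
  filter-split P? [] = refl
  filter-split P? (x ∷ xs) with does (P? x)
  ... | true  = prep x (filter-split P? xs)
  ... | false = ↭-trans (prep x (filter-split P? xs)) (↭-sym (shift x (filter P? xs) _))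

  Unique-resp-↭ : ∀ {xs ys : List A} → xs ↭ ys → Unique xs → Unique ys
  Unique-resp-↭ p = Permₛ.Unique-resp-↭ (≡.setoid A) (↭⇒↭ₛ p)

  Unique⇒length≤ : ∀ {xs ys : List A} → Unique xs → (∀ {x} → x ∈ xs → x ∈ ys) → length xs ≤ length ys
  Unique⇒length≤ {[]} _ _ = z≤n
  Unique⇒length≤ {x ∷ xs} {ys} (x∉ ∷ u) sub with ∈⇒↭ (sub (here refl))
  ... | ys′ , p = subst (suc (length xs) ≤_) (≡.sym (↭-length p)) (s≤s (Unique⇒length≤ u sub′))
    where
    sub′ : ∀ {z} → z ∈ xs → z ∈ ys′
    sub′ z∈ with ∈-resp-↭ p (sub (there z∈))
    ... | here refl = contradiction refl (All.lookup x∉ z∈)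
    ... | there z∈′ = z∈′

-- Cyclic successors and walks around a cycle.

nextMod-< : ∀ {m} (i : Fin m) → suc (toℕ i) < m → toℕ (nextMod i) ≡ suc (toℕ i)
nextMod-< {suc m} i lt with suc (toℕ i) <? suc m
... | yes p = toℕ-fromℕ< p
... | no ≮  = contradiction lt ≮

nextMod-≮ : ∀ {m} (i : Fin m) → ¬ suc (toℕ i) < m → toℕ (nextMod i) ≡ 0
nextMod-≮ {suc m} i ≮ with suc (toℕ i) <? suc m
... | yes p = contradiction p ≮
... | no _  = refl

nextMod-% : ∀ {m} (i : Fin (suc m)) → toℕ (nextMod i) ≡ suc (toℕ i) % suc m
nextMod-% {m} i with suc (toℕ i) <? suc m
... | yes p = ≡.trans (toℕ-fromℕ< p) (≡.sym (m<n⇒m%n≡m p))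
... | no ≮  = ≡.sym (≡.trans (cong (_% suc m) (≤-antisym (toℕ<n i) (≮⇒≥ ≮))) (n%n≡0 (suc m)))

nextMod-view : ∀ {m} (i : Fin m) →
  (suc (toℕ i) < m × toℕ (nextMod i) ≡ suc (toℕ i)) ⊎ (¬ suc (toℕ i) < m × toℕ (nextMod i) ≡ 0)
nextMod-view {m} i with suc (toℕ i) <? m
... | yes p = inj₁ (p , nextMod-< i p)
... | no ≮  = inj₂ (≮ , nextMod-≮ i ≮)

-- Length at least 3 is essential: it prevents a cycle from traversing one edge in both directions.
nextMod² : ∀ {l} (i : Fin (3 + l)) → nextMod (nextMod i) ≢ i
nextMod² {l} i eq with nextMod-view i | nextMod-view (nextMod i)
... | inj₁ (p , e₁) | inj₁ (_ , e₂) = m+1+n≢n 1 (≡.trans (cong suc (≡.sym e₁)) (≡.trans (≡.sym e₂) (cong toℕ eq)))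
... | inj₁ (p , e₁) | inj₂ (≮ , e₂) = ≮ (subst (λ z → suc z < 3 + l) (≡.sym e₁)
  (subst (λ z → suc (suc z) < 3 + l) (≡.trans (≡.sym e₂) (cong toℕ eq)) (s≤s (s≤s (s≤s z≤n)))))
... | inj₂ (≮ , e₁) | inj₁ (_ , e₂) =
  ≮ (subst (λ z → suc z < 3 + l) (≡.trans (≡.sym (≡.trans e₂ (cong suc e₁))) (cong toℕ eq)) (s≤s (s≤s (s≤s z≤n))))
... | inj₂ (_ , e₁) | inj₂ (≮ , _) = ≮ (subst (λ z → suc z < 3 + l) (≡.sym e₁) (s≤s (s≤s z≤n)))

rotate : ∀ {m} → ℕ → Fin m → Fin m
rotate zero    i = i
rotate (suc j) i = nextMod (rotate j i)

rotate-full : ∀ {m} (i : Fin m) → rotate m i ≡ i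
rotate-full {suc m} i = toℕ-injective (≡.trans (go (suc m)) (≡.trans ([m+n]%n≡m%n (toℕ i) (suc m)) (m<n⇒m%n≡m (toℕ<n i))))
  where
  open ≡.≡-Reasoning
  n = suc m
  go : ∀ j → toℕ (rotate j i) ≡ (toℕ i + j) % n
  go zero    = ≡.trans (≡.sym (m<n⇒m%n≡m (toℕ<n i))) (cong (_% n) (≡.sym (+-identityʳ (toℕ i))))
  go (suc j) = begin
    toℕ (nextMod (rotate j i))                 ≡⟨ nextMod-% (rotate j i) ⟩
    suc (toℕ (rotate j i)) % n                 ≡⟨ cong (λ z → suc z % n) (go j) ⟩
    (1 + (toℕ i + j) % n) % n                  ≡⟨ %-distribˡ-+ 1 ((toℕ i + j) % n) n ⟩
    (1 % n + ((toℕ i + j) % n) % n) % n        ≡⟨ cong (λ z → (1 % n + z) % n) (m%n%n≡m%n (toℕ i + j) n) ⟩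
    (1 % n + (toℕ i + j) % n) % n              ≡⟨ %-distribˡ-+ 1 (toℕ i + j) n ⟨
    suc (toℕ i + j) % n                        ≡⟨ cong (_% n) (+-suc (toℕ i) j) ⟨
    (toℕ i + suc j) % n                        ∎

-- Since `stop` is available at every `ℓ`, the index is an upper bound for the length of the walk,
-- not its exact length.
data Reach {A : Set} (e : A → A → Bool) : ℕ → A → A → Set where
  stop : ∀ {ℓ x} → Reach e ℓ x x
  step : ∀ {ℓ x y z} → e x y ≡ true → Reach e ℓ y z → Reach e (suc ℓ) x z

module _ {A : Set} {e : A → A → Bool} where

  Reach-weaken : ∀ {ℓ x y} → Reach e ℓ x y → Reach e (suc ℓ) x y
  Reach-weaken stop       = stop
  Reach-weaken (step p w) = step p (Reach-weaken w)

  Reach-snoc : ∀ {ℓ x y z} → Reach e ℓ x y → e y z ≡ true → Reach e (suc ℓ) x z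
  Reach-snoc stop       q = step q stop
  Reach-snoc (step p w) q = step p (Reach-snoc w q)

  Reach-sym : (∀ x y → e x y ≡ e y x) → ∀ {ℓ x y} → Reach e ℓ x y → Reach e ℓ y x
  Reach-sym e-sym stop = stop
  Reach-sym e-sym (step {x = x} {y} p w) = Reach-snoc (Reach-sym e-sym w) (≡.trans (e-sym y x) p)

  around : ∀ {l} (c : Fin (suc l) → A) i → (∀ j → j ≢ i → e (c j) (c (nextMod j)) ≡ true) →
    Reach e l (c (nextMod i)) (c i)
  around {l} c i edges with go l
    where
    go : ∀ j → Reach e j (c (nextMod i)) (c i) ⊎ Reach e j (c (nextMod i)) (c (rotate (suc j) i))
    go zero = inj₂ stop
    go (suc j) with go j
    ... | inj₁ w = inj₁ (Reach-weaken w)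
    ... | inj₂ w with rotate (suc j) i ≟ i
    ...   | yes eq = inj₁ (Reach-weaken (subst (Reach e j _ ∘ c) eq w))
    ...   | no neq = inj₂ (Reach-snoc w (edges _ neq))
  ... | inj₁ w = w
  ... | inj₂ w = subst (λ v → Reach e l (c (nextMod i)) (c v)) (rotate-full i) w

-- Multiplicities, and balls under a degree bound.

module _ {n : ℕ} where

  open DecMembership (_≟_ {n}) using (_∈?_)

  mult : Fin n → List (Fin n) → ℕ
  mult x xs = length (filter (x ≟_) xs)

  mult-↭ : ∀ x {xs ys} → xs ↭ ys → mult x xs ≡ mult x ys
  mult-↭ x p = ↭-length (filter-↭ (x ≟_) p)

  mult-filter : ∀ {p} {P : Pred (Fin n) p} (P? : Decidable P) x xs → mult x (filter P? xs) ≤ mult x xs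
  mult-filter P? x xs = ≤-trans (≤-reflexive (cong length (filter-comm (x ≟_) P? xs))) (length-filter P? (filter (x ≟_) xs))

  length≤mult : ∀ bs us D → (∀ {x} → x ∈ us → x ∈ bs) → (∀ x → mult x us ≤ D) → length us ≤ length bs * D
  length≤mult [] [] D sub _ = z≤n
  length≤mult [] (u ∷ us) D sub _ with () ← sub (here refl)
  length≤mult (b ∷ bs) us D sub bound = begin
    length us                                                ≡⟨ ↭-length (filter-split (b ≟_) us) ⟩
    length (filter (b ≟_) us ++ rest)                        ≡⟨ length-++ (filter (b ≟_) us) ⟩
    mult b us + length rest                                  ≤⟨ +-mono-≤ (bound b) (length≤mult bs rest D sub′
                                                                  (λ x → ≤-trans (mult-filter (¬? ∘ (b ≟_)) x us) (bound x))) ⟩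
    D + length bs * D                                        ∎
    where
    open ≤-Reasoning
    rest = filter (¬? ∘ (b ≟_)) us
    sub′ : ∀ {x} → x ∈ rest → x ∈ bs
    sub′ x∈ with ∈-filter⁻ (¬? ∘ (b ≟_)) x∈
    ... | x∈us , b≢x with sub x∈us
    ...   | here refl = contradiction refl b≢x
    ...   | there x∈bs = x∈bs

  ball : (Fin n → List (Fin n)) → ℕ → Fin n → List (Fin n)
  ball nb zero    x = x ∷ []
  ball nb (suc ℓ) x = x ∷ concatMap (ball nb ℓ) (nb x)

  length-concatMap≤ : ∀ {A : Set} (f : A → List (Fin n)) b → (∀ x → length (f x) ≤ b) → ∀ xs →
    length (concatMap f xs) ≤ length xs * b
  length-concatMap≤ f b h [] = z≤n
  length-concatMap≤ f b h (x ∷ xs) = ≤-trans (≤-reflexive (length-++ (f x))) (+-mono-≤ (h x) (length-concatMap≤ f b h xs))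

  length-ball : ∀ nb D → (∀ x → length (nb x) ≤ D) → ∀ ℓ x → length (ball nb ℓ x) ≤ suc D ^ ℓ
  length-ball nb D deg zero    x = ≤-refl
  -- The base `suc D` absorbs the centre: 1 + D q is at most (D + 1) q for positive q.
  length-ball nb D deg (suc ℓ) x = +-mono-≤ (m^n>0 (suc D) ℓ)
    (≤-trans (length-concatMap≤ (ball nb ℓ) _ (length-ball nb D deg ℓ) (nb x)) (*-monoˡ-≤ (suc D ^ ℓ) (deg x)))

  Reach⇒∈ball : ∀ {e : Fin n → Fin n → Bool} nb → (∀ x y → e x y ≡ true → y ∈ nb x) →
    ∀ {ℓ x y} → Reach e ℓ x y → y ∈ ball nb ℓ x
  Reach⇒∈ball nb cover {zero} stop = here refl
  Reach⇒∈ball nb cover {suc ℓ} stop = here refl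
  Reach⇒∈ball nb cover {suc ℓ} (step {x = x} {y} p w) =
    there (∈-concatMap⁺ (ball nb ℓ) (Any.map (λ { refl → Reach⇒∈ball nb cover w }) (cover x y p)))

-- Greedy construction of dense graphs without a cycle of given length.

module _ {m : ℕ} (G : Graph m) (x y : Fin m) (x≢y : x ≢ y) where

  private
    link : Fin m → Fin m → Bool
    link i j = (does (i ≟ x) ∧ does (j ≟ y)) ∨ (does (i ≟ y) ∧ does (j ≟ x))

    link-sym : ∀ i j → link i j ≡ link j i
    link-sym i j = ≡.trans (∨-comm (does (i ≟ x) ∧ does (j ≟ y)) _)
      (cong₂ _∨_ (∧-comm (does (i ≟ y)) _) (∧-comm (does (i ≟ x)) _))

    link-irrefl : ∀ i → link i i ≡ false
    link-irrefl i with i ≟ x | i ≟ y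
    ... | yes p | yes q = contradiction (≡.trans (≡.sym p) q) x≢y
    ... | yes _ | no _  = refl
    ... | no _  | yes _ = refl
    ... | no _  | no _  = refl

    link-true : ∀ i j → link i j ≡ true → (i ≡ x × j ≡ y) ⊎ (i ≡ y × j ≡ x)
    link-true i j p with i ≟ x | j ≟ y | i ≟ y | j ≟ x
    ... | yes a | yes b | _     | _     = inj₁ (a , b)
    ... | yes a | no  _ | yes c | yes d = inj₂ (c , d)
    ... | no  _ | _     | yes c | yes d = inj₂ (c , d)

  addEdge : Graph m
  addEdge .adj i j  = adj G i j ∨ link i j
  addEdge .sym i j  = cong₂ _∨_ (sym G i j) (link-sym i j)
  addEdge .irrefl i = cong₂ _∨_ (irrefl G i) (link-irrefl i)

  addEdge-true : ∀ i j → adj addEdge i j ≡ true →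
    adj G i j ≡ true ⊎ (i ≡ x × j ≡ y) ⊎ (i ≡ y × j ≡ x)
  addEdge-true i j p with adj G i j
  ... | true  = inj₁ refl
  ... | false = inj₂ (link-true i j p)

  addEdge-mono : ∀ i j → T (adj G i j) → T (adj addEdge i j)
  addEdge-mono i j p with adj G i j
  ... | true = p

  addEdge-new : T (adj addEdge x y)
  addEdge-new rewrite dec-true (x ≟ x) refl | dec-true (y ≟ y) refl | ∨-zeroʳ (adj G x y) = _

  -- With `x` and `y` moved to the front of the vertex list, the new edge is visible as one
  -- additional entry among the neighbours of `x`.
  kr-addEdge : adj G x y ≡ false → suc (kr 2 G) ≤ kr 2 addEdge
  kr-addEdge xy-false with ∈⇒↭ (∈-allFin x)
  ... | ys , p with ∈-resp-↭ p (∈-allFin y)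
  ...   | here y≡x = contradiction (≡.sym y≡x) x≢y
  ...   | there y∈ with ∈⇒↭ y∈
  ...     | zs , q = begin
    suc (kr 2 G)                        ≡⟨ cong suc (≡.trans (kr≡K 2 G) (K-↭ (adj G) (sym G) 2 allFin↭)) ⟩
    suc (K (adj G) 2 (x ∷ y ∷ zs))      ≤⟨ step₁ ⟩
    K (adj addEdge) 2 (x ∷ y ∷ zs)      ≡⟨ ≡.trans (kr≡K 2 addEdge) (K-↭ (adj addEdge) (sym addEdge) 2 allFin↭) ⟨
    kr 2 addEdge                        ∎
    where
    open ≤-Reasoning
    allFin↭ : allFin m ↭ x ∷ y ∷ zs
    allFin↭ = ↭-trans p (prep x q)
    new : length (nbrs (adj addEdge) x (y ∷ zs)) ≡ suc (length (nbrs (adj addEdge) x zs))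
    new = cong length (filter-accept (T? ∘ adj addEdge x) addEdge-new)
    old : length (nbrs (adj G) x (y ∷ zs)) ≡ length (nbrs (adj G) x zs)
    old = cong length (filter-reject (T? ∘ adj G x) (subst T xy-false))
    step₁ : suc (K (adj G) 2 (x ∷ y ∷ zs)) ≤ K (adj addEdge) 2 (x ∷ y ∷ zs)
    step₁ = begin
      suc (K (adj G) 2 (y ∷ zs) + K (adj G) 1 (nbrs (adj G) x (y ∷ zs)))
        ≡⟨ cong (λ z → suc (K (adj G) 2 (y ∷ zs) + z)) (≡.trans (K-one (adj G) (nbrs (adj G) x (y ∷ zs))) old) ⟩
      suc (K (adj G) 2 (y ∷ zs) + length (nbrs (adj G) x zs))
        ≡⟨ +-suc _ _ ⟨
      K (adj G) 2 (y ∷ zs) + suc (length (nbrs (adj G) x zs))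
        ≤⟨ +-mono-≤ (K-mono-adj (adj G) (adj addEdge) addEdge-mono 2 (y ∷ zs)) (s≤s nbrs≤) ⟩
      K (adj addEdge) 2 (y ∷ zs) + suc (length (nbrs (adj addEdge) x zs))
        ≡⟨ cong (K (adj addEdge) 2 (y ∷ zs) +_) (≡.trans (K-one (adj addEdge) (nbrs (adj addEdge) x (y ∷ zs))) new) ⟨
      K (adj addEdge) 2 (x ∷ y ∷ zs) ∎
      where
      nbrs≤ : length (nbrs (adj G) x zs) ≤ length (nbrs (adj addEdge) x zs)
      nbrs≤ = length-mono-≤ (filter⁺ (T? ∘ adj G x) (T? ∘ adj addEdge x) (λ { refl → addEdge-mono x _ }) (⊆-refl {x = zs}))

  -- A new cycle must use the added edge, and it uses it only once; the remaining edges form a walk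
  -- of length at most `2 + l` between `x` and `y` in the old graph.
  addEdge-free : ∀ {l} → ¬ HasCycle (3 + l) G → ¬ Reach (adj G) (2 + l) x y → ¬ HasCycle (3 + l) addEdge
  addEdge-free {l} free far (c′ , inj , edges) with any? (λ i → ¬? (adj G (c′ zero i) (c′ zero (nextMod i)) ≟ᵇ true))
  ... | no none = free (c′ , inj , λ { zero i → decidable-stable (_ ≟ᵇ true) (λ ne → none (i , ne)) })
  ... | yes (i , new) = far (reach (split i))
    where
    c : Fin (3 + l) → Fin m
    c = c′ zero
    c-inj : ∀ {i j} → c i ≡ c j → i ≡ j
    c-inj {i} {j} eq = proj₂ (inj zero zero i j eq)
    split : ∀ j → adj G (c j) (c (nextMod j)) ≡ true ⊎ (c j ≡ x × c (nextMod j) ≡ y) ⊎ (c j ≡ y × c (nextMod j) ≡ x)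
    split j = addEdge-true (c j) (c (nextMod j)) (edges zero j)
    -- A second use of the added edge in the opposite direction would make `i` its own second
    -- successor.
    back : ∀ {j} → c j ≡ c (nextMod i) → c (nextMod j) ≡ c i → ⊥
    back e₁ e₂ = nextMod² i (≡.trans (cong nextMod (≡.sym (c-inj e₁))) (c-inj e₂))
    others : (c i ≡ x × c (nextMod i) ≡ y) ⊎ (c i ≡ y × c (nextMod i) ≡ x) →
      ∀ j → j ≢ i → adj G (c j) (c (nextMod j)) ≡ true
    others hi j j≢i with split j | hi
    ... | inj₁ p | _ = p
    ... | inj₂ (inj₁ (a , b)) | inj₁ (a′ , b′) = contradiction (c-inj (≡.trans a (≡.sym a′))) j≢i
    ... | inj₂ (inj₁ (a , b)) | inj₂ (a′ , b′) = ⊥-elim (back (≡.trans a (≡.sym b′)) (≡.trans b (≡.sym a′)))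
    ... | inj₂ (inj₂ (a , b)) | inj₁ (a′ , b′) = ⊥-elim (back (≡.trans a (≡.sym b′)) (≡.trans b (≡.sym a′)))
    ... | inj₂ (inj₂ (a , b)) | inj₂ (a′ , b′) = contradiction (c-inj (≡.trans a (≡.sym a′))) j≢i
    reach : adj G (c i) (c (nextMod i)) ≡ true ⊎ (c i ≡ x × c (nextMod i) ≡ y) ⊎ (c i ≡ y × c (nextMod i) ≡ x) →
      Reach (adj G) (2 + l) x y
    reach (inj₁ p) = contradiction p new
    reach (inj₂ h@(inj₁ (a , b))) = ≡.subst₂ (Reach (adj G) (2 + l)) a b (Reach-sym (sym G) (around c i (others h)))
    reach (inj₂ h@(inj₂ (a , b))) = ≡.subst₂ (Reach (adj G) (2 + l)) b a (around c i (others h))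

-- A C_L-free graph under construction, with a list of unused stubs: a vertex x may still
-- receive as many edges as it occurs in the list.
record Partial (l D m : ℕ) (stubs : List (Fin m)) : Set where
  field
    graph : Graph m
    nb    : Fin m → List (Fin m)
    cover : ∀ x y → adj graph x y ≡ true → y ∈ nb x
    deg   : ∀ x → length (nb x) + mult x stubs ≤ D
    free  : ¬ HasCycle (3 + l) graph
    edges : D * m ≤ 2 * kr 2 graph + length stubs

-- When the process stops, every stub after the first lies in the ball of radius `2 + l` around the
-- first one, and each vertex has at most `D` stubs. The outer `suc` counts the first stub.
stubBound : ℕ → ℕ → ℕ
stubBound l D = suc (suc D ^ (2 + l) * D)

module _ {l D m : ℕ} where

  open DecMembership (_≟_ {m}) using (_∈?_)

  -- Both used stubs turn into entries of neighbour lists, so the sum in `deg` is unchanged, and the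
  -- one new edge pays for two stubs in `edges`.
  extend : ∀ {x y us} (P : Partial l D m (x ∷ y ∷ us)) → y ∉ ball (Partial.nb P) (2 + l) x → Partial l D m us
  extend {x} {y} {us} P y∉ = record
    { graph = addEdge graph x y x≢y
    ; nb    = nb′
    ; cover = λ i j p → cover′ i j (addEdge-true graph x y x≢y i j p)
    ; deg   = λ i → ≤-trans (≤-reflexive (deg′ i)) (deg i)
    ; free  = addEdge-free graph x y x≢y free far
    ; edges = edges′
    }
    where
    open Partial P
    far : ¬ Reach (adj graph) (2 + l) x y
    far w = y∉ (Reach⇒∈ball nb cover w)
    x≢y : x ≢ y
    x≢y refl = far stop
    xy-false : adj graph x y ≡ false
    xy-false with adj graph x y in eq
    ... | true  = contradiction (step eq stop) far
    ... | false = refl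
    end : Fin m → Fin m → Fin m → List (Fin m)
    end u v i = if does (i ≟ u) then v ∷ [] else []
    nb′ : Fin m → List (Fin m)
    nb′ i = end x y i ++ end y x i ++ nb i
    cover′ : ∀ i j → adj graph i j ≡ true ⊎ (i ≡ x × j ≡ y) ⊎ (i ≡ y × j ≡ x) → j ∈ nb′ i
    cover′ i j (inj₁ p) = ∈-++⁺ʳ (end x y i) (∈-++⁺ʳ (end y x i) (cover i j p))
    cover′ _ _ (inj₂ (inj₁ (refl , refl))) rewrite dec-true (x ≟ x) refl = here refl
    cover′ _ _ (inj₂ (inj₂ (refl , refl))) rewrite dec-true (y ≟ y) refl = ∈-++⁺ʳ (end x y y) (here refl)
    deg′ : ∀ i → length (nb′ i) + mult i us ≡ length (nb i) + mult i (x ∷ y ∷ us)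
    deg′ i with i ≟ x
    deg′ i | yes _ with i ≟ y
    ... | yes _ = ≡.sym (≡.trans (+-suc _ _) (cong suc (+-suc _ _)))
    ... | no _  = ≡.sym (+-suc _ _)
    deg′ i | no _ with i ≟ y
    ... | yes _ = ≡.sym (+-suc _ _)
    ... | no _  = refl
    edges′ : D * m ≤ 2 * kr 2 (addEdge graph x y x≢y) + length us
    edges′ = begin
      D * m                                        ≤⟨ edges ⟩
      2 * kr 2 graph + (2 + length us)             ≡⟨ shuffle (kr 2 graph) (length us) ⟩
      2 * suc (kr 2 graph) + length us             ≤⟨ +-monoˡ-≤ (length us) (*-monoʳ-≤ 2 (kr-addEdge graph x y x≢y xy-false)) ⟩
      2 * kr 2 (addEdge graph x y x≢y) + length us ∎
      where
      open ≤-Reasoning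
      shuffle : ∀ a b → 2 * a + (2 + b) ≡ 2 * suc a + b
      shuffle = solve-∀

  reorder : ∀ {us vs} → us ↭ vs → Partial l D m us → Partial l D m vs
  reorder p P = record
    { graph = graph ; nb = nb ; cover = cover ; free = free
    ; deg   = λ x → subst (λ k → length (nb x) + k ≤ D) (mult-↭ x p) (deg x)
    ; edges = subst (λ k → D * m ≤ 2 * kr 2 graph + k) (↭-length p) edges
    }
    where open Partial P

  -- The first stub is joined to any other stub outside its ball. If there is none, all the others
  -- lie in the ball and `stubBound` applies.
  saturate : ∀ fuel us → length us ≤ fuel → Partial l D m us →
    Σ (List (Fin m)) λ vs → Partial l D m vs × length vs ≤ stubBound l D
  saturate fuel       []       _        P = [] , P , z≤n
  saturate (suc fuel) (x ∷ us) (s≤s le) P with Any.any? (λ y → ¬? (y ∈? ball (Partial.nb P) (2 + l) x)) us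
  ... | yes a = saturate fuel (proj₁ q) shorter (extend (reorder (prep x (proj₂ q)) P) (proj₂ (proj₂ (find a))))
    where
    q : Σ (List (Fin m)) λ ys → us ↭ proj₁ (find a) ∷ ys
    q = ∈⇒↭ (proj₁ (proj₂ (find a)))
    shorter : length (proj₁ q) ≤ fuel
    shorter = ≤-trans (n≤1+n _) (≤-trans (≤-reflexive (≡.sym (↭-length (proj₂ q)))) le)
  ... | no none = x ∷ us , P , s≤s (≤-trans
      (length≤mult (ball nb (2 + l) x) us D
        (λ {y} y∈ → decidable-stable (y ∈? ball nb (2 + l) x) λ y∉ → none (Any.map (λ { refl → y∉ }) y∈))
        (λ z → ≤-trans (mult-∷ z) (≤-trans (m≤n+m _ (length (nb z))) (deg z))))
      (*-monoˡ-≤ D (length-ball nb D (λ z → ≤-trans (m≤m+n _ _) (deg z)) (2 + l) x)))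
    where
    open Partial P
    mult-∷ : ∀ z → mult z us ≤ mult z (x ∷ us)
    mult-∷ z with does (z ≟ x)
    ... | true  = n≤1+n _
    ... | false = ≤-refl

  start : Partial l D m (concat (replicate D (allFin m)))
  start = record
    { graph = record { adj = λ _ _ → false ; sym = λ _ _ → refl ; irrefl = λ _ → refl }
    ; nb    = λ _ → []
    ; cover = λ _ _ ()
    ; deg   = λ x → go x D
    ; free  = λ { (_ , _ , edge) → true≢false (edge zero zero) }
    ; edges = m≤n⇒m≤o+n _ (≤-reflexive (≡.sym (len D)))
    }
    where
    true≢false : false ≡ true → ⊥
    true≢false ()
    mult-allFin : ∀ x → mult x (allFin m) ≤ 1
    mult-allFin x = Unique⇒length≤ {ys = x ∷ []} (Unique-filter⁺ (x ≟_) (allFin⁺ m))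
      (λ z∈ → here (≡.sym (proj₂ (∈-filter⁻ (x ≟_) {xs = allFin m} z∈))))
    go : ∀ x d → mult x (concat (replicate d (allFin m))) ≤ d
    go x zero    = z≤n
    go x (suc d) rewrite filter-++ (x ≟_) (allFin m) (concat (replicate d (allFin m)))
                       | length-++ (filter (x ≟_) (allFin m)) {filter (x ≟_) (concat (replicate d (allFin m)))} =
      +-mono-≤ (mult-allFin x) (go x d)
    len : ∀ d → length (concat (replicate d (allFin m))) ≡ d * m
    len zero    = refl
    len (suc d) = ≡.trans (length-++ (allFin m)) (cong₂ _+_ (length-tabulate id) (len d))

-- The error `stubBound l D` does not depend on `m` while `D` is arbitrary; this is the
-- superlinearity of the Turán number.
dense-free-graph : ∀ l D m → Σ (Graph m) λ G → ¬ HasCycle (3 + l) G × D * m ≤ 2 * kr 2 G + stubBound l D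
dense-free-graph l D m with saturate {l} {D} {m} _ _ ≤-refl start
... | vs , P , short = graph , free , ≤-trans edges (+-monoʳ-≤ (2 * kr 2 graph) short)
  where open Partial P

-- Inequalities for join counts and for cliques in concatenated lists.

joinCount-mono : ∀ h r {f g} → (∀ i → i ≤ r → f i ≤ g i) → joinCount h r f ≤ joinCount h r g
joinCount-mono zero    r       f≤g = f≤g r ≤-refl
joinCount-mono (suc h) zero    f≤g = f≤g 0 ≤-refl
joinCount-mono (suc h) (suc r) f≤g =
  +-mono-≤ (joinCount-mono h (suc r) f≤g) (joinCount-mono h r (λ i i≤r → f≤g i (m≤n⇒m≤1+n i≤r)))

joinCount-zero : ∀ h f → joinCount h 0 f ≡ f 0
joinCount-zero zero    f = refl
joinCount-zero (suc h) f = refl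

joinCount-monoˡ : ∀ {h h′} r f → h ≤ h′ → joinCount h r f ≤ joinCount h′ r f
joinCount-monoˡ {h} {h′} zero f _ = ≤-reflexive (≡.trans (joinCount-zero h f) (≡.sym (joinCount-zero h′ f)))
joinCount-monoˡ {h′ = zero}   (suc r) f z≤n = ≤-refl
joinCount-monoˡ {h′ = suc h′} (suc r) f z≤n = m≤n⇒m≤n+o _ (joinCount-monoˡ {0} {h′} (suc r) f z≤n)
joinCount-monoˡ (suc r) f (s≤s h≤h′) = +-mono-≤ (joinCount-monoˡ (suc r) f h≤h′) (joinCount-monoˡ r f h≤h′)

private
  double : ∀ k X → 2 ^ k * X + 2 ^ k * X ≡ 2 ^ suc k * X
  double k X = lemma (2 ^ k) X
    where
    lemma : ∀ a b → a * b + a * b ≡ (2 * a) * b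
    lemma = solve-∀

-- The error is multiplied by a sum of binomial coefficients of `h`, hence by at most `2 ^ h`.
joinCount-+const : ∀ h r f X → joinCount h r (λ i → f i + X) ≤ joinCount h r f + 2 ^ h * X
joinCount-+const zero    r       f X = +-monoʳ-≤ (f r) (≤-reflexive (≡.sym (+-identityʳ X)))
joinCount-+const (suc h) zero    f X = +-monoʳ-≤ (f 0) (m≤n*m X (2 ^ suc h) {{m^n≢0 2 (suc h)}})
joinCount-+const (suc h) (suc r) f X = begin
  joinCount h (suc r) (λ i → f i + X) + joinCount h r (λ i → f i + X)
    ≤⟨ +-mono-≤ (joinCount-+const h (suc r) f X) (joinCount-+const h r f X) ⟩
  (joinCount h (suc r) f + 2 ^ h * X) + (joinCount h r f + 2 ^ h * X)
    ≡⟨ interchange (joinCount h (suc r) f) (2 ^ h * X) (joinCount h r f) ⟩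
  joinCount h (suc r) f + joinCount h r f + (2 ^ h * X + 2 ^ h * X)
    ≡⟨ cong (joinCount h (suc r) f + joinCount h r f +_) (double h X) ⟩
  joinCount (suc h) (suc r) f + 2 ^ suc h * X ∎
  where
  open ≤-Reasoning
  interchange : ∀ a b c → (a + b) + (c + b) ≡ a + c + (b + b)
  interchange = solve-∀

joinCount≤const : ∀ h r {f} X → (∀ i → f i ≤ X) → joinCount h r f ≤ 2 ^ h * X
joinCount≤const zero    r       X f≤ = ≤-trans (f≤ r) (≤-reflexive (≡.sym (+-identityʳ X)))
joinCount≤const (suc h) zero    X f≤ = ≤-trans (f≤ 0) (m≤n*m X (2 ^ suc h) {{m^n≢0 2 (suc h)}})
joinCount≤const (suc h) (suc r) X f≤ =
  ≤-trans (+-mono-≤ (joinCount≤const h (suc r) X f≤) (joinCount≤const h r X f≤)) (≤-reflexive (double h X))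

-- The coefficient C(h, r - j) of `f j` is positive because r - j lies between 0 and h.
term≤joinCount : ∀ h r j f → j ≤ r → r ≤ j + h → f j ≤ joinCount h r f
term≤joinCount zero r j f j≤r r≤j =
  ≤-reflexive (cong f (≤-antisym j≤r (≤-trans r≤j (≤-reflexive (+-identityʳ j)))))
term≤joinCount (suc h) zero .0 f z≤n _ = ≤-refl
term≤joinCount (suc h) (suc r) j f j≤ r≤ with j ≤? r
... | yes j≤r = m≤n⇒m≤o+n _ (term≤joinCount h r j f j≤r (≤-pred (≤-trans r≤ (≤-reflexive (+-suc j h)))))
... | no j≰r  = m≤n⇒m≤n+o _ (term≤joinCount h (suc r) j f j≤ (m≤n⇒m≤n+o h (≰⇒> j≰r)))

module _ {A : Set} (e : A → A → Bool) where

  -- Distributing a clique over `xs` and `ys` and ignoring which vertices of `xs` are adjacent to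
  -- what can only increase the count.
  K-++≤joinCount : ∀ r xs ys → K e r (xs ++ ys) ≤ joinCount (length xs) r (λ i → K e i ys)
  K-++≤joinCount r       []       ys = ≤-refl
  K-++≤joinCount zero    (x ∷ xs) ys = ≤-refl
  K-++≤joinCount (suc r) (x ∷ xs) ys = +-mono-≤ (K-++≤joinCount (suc r) xs ys)
    (≤-trans (K-nbrs e r x (xs ++ ys)) (K-++≤joinCount r xs ys))

  -- Each vertex of `xs` accounts for at most `X` cliques. The ambient list `zs` stays fixed in the
  -- induction, so that the hypothesis about neighbourhoods survives the shrinking of `xs`.
  K-++≤+ : ∀ r X xs ys {zs} → xs ++ ys ⊆ zs → (∀ {x} → x ∈ xs → ∀ i → K e i (nbrs e x zs) ≤ X) →
    K e r (xs ++ ys) ≤ K e r ys + length xs * X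
  K-++≤+ r       X []       ys sub h = m≤m+n _ _
  K-++≤+ zero    X (x ∷ xs) ys sub h = s≤s z≤n
  K-++≤+ (suc r) X (x ∷ xs) ys {zs} sub h = begin
    K e (suc r) (xs ++ ys) + K e r (nbrs e x (xs ++ ys))
      ≤⟨ +-mono-≤ (K-++≤+ (suc r) X xs ys sub′ (h ∘ there))
           (≤-trans (K-mono e r (filter⁺ (T? ∘ e x) (T? ∘ e x) (λ { refl → id }) sub′)) (h (here refl) r)) ⟩
    K e (suc r) ys + length xs * X + X
      ≡⟨ ≡.trans (+-assoc (K e (suc r) ys) _ X) (cong (K e (suc r) ys +_) (+-comm (length xs * X) X)) ⟩
    K e (suc r) ys + suc (length xs) * X ∎
    where
    open ≤-Reasoning
    sub′ : xs ++ ys ⊆ zs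
    sub′ = ⊆-trans (x ∷ʳ ⊆-refl) sub

-- Path-free graphs

module _ {n : ℕ} (e : Fin n → Fin n → Bool) (e-sym : ∀ x y → e x y ≡ e y x) where

  open DecMembership (_≟_ {n}) using (_∈?_)

  NoPath : ℕ → List (Fin n) → Set
  NoPath p Q = ∀ ps → length ps ≡ p → Unique ps → Linked (λ x y → T (e x y)) ps → (∀ {x} → x ∈ ps → x ∈ Q) → ⊥

  longer⇒fresh : ∀ {xs ys : List (Fin n)} → Unique xs → length ys < length xs → Σ (Fin n) λ x → x ∈ xs × x ∉ ys
  longer⇒fresh {xs} {ys} u lt with Any.any? (λ x → ¬? (x ∈? ys)) xs
  ... | yes a   = find a
  ... | no none = contradiction lt (≤⇒≯ (Unique⇒length≤ u λ {x} x∈ →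
    decidable-stable (x ∈? ys) λ x∉ → none (Any.map (λ { refl → x∉ }) x∈)))

  -- If every vertex had more than `p` neighbours, a path on at most `p` vertices could always be
  -- prolonged by a fresh neighbour of its end, up to `p + 1` vertices.
  low-degree : ∀ p q Q → Unique (q ∷ Q) → NoPath (suc p) (q ∷ Q) →
    Σ (Fin n) λ x → x ∈ q ∷ Q × length (nbrs e x (q ∷ Q)) ≤ p
  low-degree p q Q u noPath with Any.any? (λ x → length (nbrs e x (q ∷ Q)) ≤? p) (q ∷ Q)
  ... | yes a   = find a
  ... | no none = ⊥-elim (finish (grow p ≤-refl))
    where
    High : ℕ → Set
    High j = Σ (Fin n) λ x → Σ (List (Fin n)) λ ps → length ps ≡ j × Unique (x ∷ ps) ×
      Linked (λ x y → T (e x y)) (x ∷ ps) × (∀ {y} → y ∈ x ∷ ps → y ∈ q ∷ Q)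
    grow : ∀ j → j ≤ p → High j
    grow zero    _ = q , [] , refl , [] ∷ [] , [-] , λ { (here refl) → here refl }
    grow (suc j) j<p with grow j (≤-trans (n≤1+n j) j<p)
    ... | x , ps , refl , u′ , link , sub
      with longer⇒fresh {nbrs e x (q ∷ Q)} {x ∷ ps} (Unique-filter⁺ (T? ∘ e x) u)
             (≤-trans (s≤s j<p) (≰⇒> λ le → none (Any.map (λ { refl → le }) (sub (here refl)))))
    ...   | y , y∈ , y∉ with ∈-filter⁻ (T? ∘ e x) {xs = q ∷ Q} y∈
    ...     | y∈Q , exy = y , x ∷ ps , refl , All.tabulate (λ { z∈ refl → y∉ z∈ }) ∷ u′ ,
      subst T (e-sym x y) exy ∷ link , λ { (here refl) → y∈Q ; (there z∈) → sub z∈ }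
    finish : High p → ⊥
    finish (x , ps , refl , u′ , link , sub) = noPath (x ∷ ps) refl u′ link sub

  -- Path-free graphs are degenerate, so removing low-degree vertices one at a time bounds the clique count.
  K-pathFree : ∀ p r Q → Unique Q → NoPath (suc p) Q → K e r Q ≤ 2 ^ p * suc (length Q)
  K-pathFree p r Q = go (length Q) r Q ≤-refl
    where
    go : ∀ fuel r Q → length Q ≤ fuel → Unique Q → NoPath (suc p) Q → K e r Q ≤ 2 ^ p * suc (length Q)
    go fuel       zero    Q       _   _ _      = *-mono-≤ (m^n>0 2 p) (s≤s (z≤n {length Q}))
    go fuel       (suc r) []      _   _ _      = z≤n
    go (suc fuel) (suc r) (q ∷ Q) (s≤s le) u noPath with low-degree p q Q u noPath
    ... | x , x∈ , low with ∈⇒↭ x∈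
    ...   | R , perm = begin
      K e (suc r) (q ∷ Q)
        ≡⟨ K-↭ e e-sym (suc r) perm ⟩
      K e (suc r) R + K e r (nbrs e x R)
        -- The cliques through `x` come from its at most `p` neighbours in `R`, so there are at most
        -- `2 ^ p` of them.
        ≤⟨ +-mono-≤ (go fuel (suc r) R (≤-trans (≤-reflexive (≡.sym len)) le) (tail-Unique (Unique-resp-↭ perm u))
                        (λ ps l u′ li sub → noPath ps l u′ li (∈-resp-↭ (↭-sym perm) ∘ there ∘ sub)))
                    (≤-trans (K≤2^length e r (nbrs e x R)) (^-monoʳ-≤ 2 few)) ⟩
      2 ^ p * suc (length R) + 2 ^ p
        ≡⟨ ≡.trans (+-comm _ (2 ^ p)) (≡.sym (*-suc (2 ^ p) (suc (length R)))) ⟩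
      2 ^ p * suc (suc (length R))
        ≡⟨ cong (λ z → 2 ^ p * suc (suc z)) len ⟨
      2 ^ p * suc (length (q ∷ Q)) ∎
      where
      open ≤-Reasoning
      len : length Q ≡ length R
      len = cong pred (↭-length perm)
      tail-Unique : ∀ {z zs} → Unique {A = Fin n} (z ∷ zs) → Unique zs
      tail-Unique (_ ∷ u) = u
      few : length (nbrs e x R) ≤ p
      few = ≤-trans (length-mono-≤ (filter⁺ (T? ∘ e x) (T? ∘ e x) (λ { refl → id }) (x ∷ʳ ⊆-refl {x = R})))
        (≤-trans (≤-reflexive (≡.sym (↭-length (filter-↭ (T? ∘ e x) perm)))) low)

-- Bounds from extremal numbers

isolate : ∀ {m} → Graph m → Graph (suc m)
isolate G .adj zero    _       = false
isolate G .adj (suc i) zero    = false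
isolate G .adj (suc i) (suc j) = adj G i j
isolate G .sym zero    zero    = refl
isolate G .sym zero    (suc j) = refl
isolate G .sym (suc i) zero    = refl
isolate G .sym (suc i) (suc j) = sym G i j
isolate G .irrefl zero    = refl
isolate G .irrefl (suc i) = irrefl G i

isolate-free : ∀ {m} L (G : Graph m) → ¬ HasCycle L G → ¬ HasCycle L (isolate G)
isolate-free L G free (c , inj , edges) = free (cycles-avoiding-zero 1 L (isolate G) c inj edges avoid)
  where
  avoid : ∀ a i → c a i ≢ zero
  avoid a i eq with () ← ≡.trans (≡.sym (cong (λ v → adj (isolate G) v (c a (nextMod i))) eq)) (edges a i)

kr≤kr-isolate : ∀ {m} r (G : Graph m) → kr r G ≤ kr r (isolate G)
kr≤kr-isolate zero    G = ≤-reflexive (≡.trans (kr-zero G) (≡.sym (kr-zero (isolate G))))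
kr≤kr-isolate (suc r) G = ≤-trans (m≤m+n (kr (suc r) G) _) (≤-reflexive (≡.sym (kr-suc r (isolate G))))

-- Padding `H` with `d` isolated vertices creates no cycle and loses no clique, so extremal numbers
-- are monotone in the number of vertices.
kr≤ex : ∀ {m i L x} → IsEx m i L x → ∀ d {m′} → d + m′ ≡ m → (H : Graph m′) → ¬ HasCycle L H → kr i H ≤ x
kr≤ex isEx zero    refl H free = proj₂ isEx H free
kr≤ex {i = i} {L} isEx (suc d) eq H free = ≤-trans (kr≤kr-isolate i H)
  (kr≤ex isEx d (≡.trans (+-suc d _) eq) (isolate H) (isolate-free L H free))

lookup-injective : ∀ {A : Set} {xs : List A} → Unique xs → ∀ i j → lookup xs i ≡ lookup xs j → i ≡ j
lookup-injective (x∉ ∷ u) zero    zero    eq = refl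
lookup-injective {xs = _ ∷ xs} (x∉ ∷ u) zero (suc j) eq = contradiction eq (All.lookup x∉ (∈-lookup {xs = xs} j))
lookup-injective {xs = _ ∷ xs} (x∉ ∷ u) (suc i) zero eq = contradiction (≡.sym eq) (All.lookup x∉ (∈-lookup {xs = xs} i))
lookup-injective (x∉ ∷ u) (suc i) (suc j) eq = cong suc (lookup-injective u i j eq)

Linked-lookup : ∀ {A : Set} {R : A → A → Set} {xs} → Linked R xs → ∀ i j → toℕ j ≡ suc (toℕ i) →
  R (lookup xs i) (lookup xs j)
Linked-lookup (r ∷ _) zero    (suc zero)    _  = r
Linked-lookup (_ ∷ l) (suc i) (suc j)       eq = Linked-lookup l i j (cong pred eq)
Linked-lookup [-] zero (suc ()) _

-- Heavy and light vertices

module _ {n : ℕ} (G : Graph n) (L : ℕ) where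

  IsCycle : (Fin L → Fin n) → Set
  IsCycle c = (∀ i j → c i ≡ c j → i ≡ j) × (∀ i → adj G (c i) (c (nextMod i)) ≡ true)

  Hits : List (Fin n) → Set
  Hits A = ∀ c → IsCycle c → ¬ (∀ i → c i ∉ A)

  Family : ℕ → List (Fin n) → Set
  Family m A = Σ (Fin m → Fin L → Fin n) λ c →
    (∀ a b i j → c a i ≡ c b j → (a ≡ b) × (i ≡ j)) ×
    (∀ a i → adj G (c a i) (c a (nextMod i)) ≡ true) × (∀ a i → c a i ∉ A)

  Family-∷ : ∀ {m A} c → IsCycle c → (∀ i → c i ∉ A) → ((d , _) : Family m A) → (∀ a i j → d a i ≢ c j) →
    Family (suc m) A
  Family-∷ {m} {A} c (c-inj , c-edge) c∉ (d , d-inj , d-edge , d∉) apart = f , inj , edge , avoid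
    where
    f : Fin (suc m) → Fin L → Fin n
    f zero    = c
    f (suc a) = d a
    inj : ∀ a b i j → f a i ≡ f b j → (a ≡ b) × (i ≡ j)
    inj zero    zero    i j eq = refl , c-inj i j eq
    inj zero    (suc b) i j eq = contradiction (≡.sym eq) (apart b j i)
    inj (suc a) zero    i j eq = contradiction eq (apart a i j)
    inj (suc a) (suc b) i j eq = cong suc (proj₁ (d-inj a b i j eq)) , proj₂ (d-inj a b i j eq)
    edge : ∀ a i → adj G (f a i) (f a (nextMod i)) ≡ true
    edge zero    = c-edge
    edge (suc a) = d-edge a
    avoid : ∀ a i → f a i ∉ A
    avoid zero    = c∉
    avoid (suc a) = d∉ a

  -- Existence of cycles and hitting sets is only claimed up to double negation (continuations into ⊥);
  -- this suffices because the inequality to be proved is decidable.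
  hitting-set : ∀ j A → ¬ Family (suc j) A → (∀ B → length B ≤ j * L → Hits (B ++ A) → ⊥) → ⊥
  hitting-set zero A none k = k [] z≤n λ c cyc c∉ → none (Family-∷ c cyc c∉ ((λ ()) , (λ ()) , (λ ()) , λ ()) λ ())
  -- The empty set is offered first. A cycle `c` refuting it contributes its `L` vertices to the
  -- hitting set, and one cycle fewer can then be disjoint from what has been collected.
  hitting-set (suc j) A none k = k [] z≤n λ c cyc c∉ →
    hitting-set j (tabulate c ++ A)
      (λ { (d , inj , edge , d∉) → none (Family-∷ c cyc c∉
        (d , inj , edge , λ a i → d∉ a i ∘ ∈-++⁺ʳ (tabulate c))
        (λ a i i′ eq → d∉ a i (∈-++⁺ˡ (subst (_∈ tabulate c) (≡.sym eq) (∈-tabulate⁺ i′))))) })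
      (λ B len hits → k (B ++ tabulate c)
        (≤-trans (≤-reflexive (≡.trans (length-++ B) (≡.trans (+-comm (length B) _) (cong (_+ length B) (length-tabulate c)))))
                 (+-monoʳ-≤ L len))
        (subst Hits (≡.sym (++-assoc B (tabulate c) A)) hits))

  -- The set `B` certifies lightness by meeting all cycles through `v` that avoid the already
  -- removed set `H`. It must not contain `v`, which would make it a trivial certificate.
  Light : ℕ → List (Fin n) → Fin n → Set
  Light M H v = Σ (List (Fin n)) λ B → length B ≤ M × v ∉ B ×
    (∀ c → IsCycle c → (∀ i → c i ∉ B) → (∀ i → c i ∉ H) → ∀ i → c i ≢ v)

  -- The vertices of `m` disjoint cycles avoiding `v` and `H` would certify that `v` is light: a
  -- cycle avoiding them and `H` would extend the family to `m + 1` members.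
  heavy-step : ∀ {M m H v} → ¬ Light M H v → m * L ≤ M → ¬ Family (suc m) H → ¬ Family m (v ∷ H)
  heavy-step {M} {m} {H} {v} heavy mL≤M none (d , inj , edge , d∉) = heavy (B , len , v∉B , through)
    where
    B : List (Fin n)
    B = concatMap (λ a → tabulate (d a)) (allFin m)
    d∈B : ∀ a i → d a i ∈ B
    d∈B a i = ∈-concatMap⁺ (λ a → tabulate (d a)) (Any.map (λ { refl → ∈-tabulate⁺ i }) (∈-allFin a))
    B-sound : ∀ {x} → x ∈ B → Σ (Fin m) λ a → Σ (Fin L) λ i → x ≡ d a i
    B-sound x∈ with find (∈-concatMap⁻ (λ a → tabulate (d a)) {xs = allFin m} x∈)
    ... | a , _ , x∈a = a , ∈-tabulate⁻ x∈a
    len : length B ≤ M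
    len = ≤-trans (length-concatMap≤ (λ a → tabulate (d a)) L (λ a → ≤-reflexive (length-tabulate (d a))) (allFin m))
      (≤-trans (≤-reflexive (cong (_* L) (length-allFin m))) mL≤M)
    v∉B : v ∉ B
    v∉B v∈ with B-sound v∈
    ... | a , i , eq = d∉ a i (here (≡.sym eq))
    through : ∀ c → IsCycle c → (∀ i → c i ∉ B) → (∀ i → c i ∉ H) → ∀ i → c i ≢ v
    through c cyc c∉B c∉H _ _ = none (Family-∷ c cyc c∉H (d , inj , edge , λ a i → d∉ a i ∘ there)
      λ a i j eq → c∉B j (subst (_∈ B) eq (d∈B a i)))

  -- A path among the neighbours of `v` closes up to a cycle through `v`.
  path⇒cycle : ∀ v ps → length (v ∷ ps) ≡ L → 2 ≤ L → Unique (v ∷ ps) → Linked (λ x y → T (adj G x y)) ps →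
    (∀ {x} → x ∈ ps → T (adj G v x)) →
    Σ (Fin L → Fin n) λ c → IsCycle c × (∀ i → c i ∈ v ∷ ps) × Σ (Fin L) λ i → c i ≡ v
  path⇒cycle v ps refl 2≤L u link nbr = c , (lookup-injective u , edge) , ∈-lookup {xs = v ∷ ps} , zero , refl
    where
    c : Fin (suc (length ps)) → Fin n
    c = lookup (v ∷ ps)
    link-∷ : ∀ {qs} → Linked (λ x y → T (adj G x y)) qs → (∀ {x} → x ∈ qs → T (adj G v x)) →
      Linked (λ x y → T (adj G x y)) (v ∷ qs)
    link-∷ {[]}     _ _ = [-]
    link-∷ {q ∷ qs} l a = a (here refl) ∷ l
    edge : ∀ i → adj G (c i) (c (nextMod i)) ≡ true
    edge i with nextMod-view i
    ... | inj₁ (_ , next) = Equivalence.to T-≡ (Linked-lookup (link-∷ link nbr) i (nextMod i) next)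
    -- As `L` is at least 2, position `zero` is not the last one; the closing edge leaves an entry
    -- of `ps`, which is a neighbour of `v`.
    edge zero    | inj₂ (≮ , _)    = contradiction 2≤L ≮
    edge (suc i) | inj₂ (_ , next) =
      ≡.trans (cong (adj G (lookup ps i)) (cong c (toℕ-injective {i = nextMod (suc i)} {j = zero} next)))
        (≡.trans (sym G (lookup ps i) v) (Equivalence.to T-≡ (nbr (∈-lookup {xs = ps} i))))

  -- Lightness is not decided, so the case distinction between all light and some heavy is made one
  -- vertex at a time by continuations.
  light-or-heavy : ∀ {M H} Z → (All (Light M H) Z → ⊥) → (∀ v → v ∈ Z → ¬ Light M H v → ⊥) → ⊥
  light-or-heavy []      k₁ k₂ = k₁ []
  light-or-heavy (z ∷ Z) k₁ k₂ =
    light-or-heavy Z (λ ls → k₂ z (here refl) (λ l → k₁ (l ∷ ls))) (λ v → k₂ v ∘ there)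

  -- Moving a heavy vertex into `H` lowers `j`, the bound on disjoint cycles avoiding `H`, while
  -- `length H + j` stays `t`. Peeling ends with `j = 0`, when `H` meets all cycles, or with only
  -- light vertices left.
  peel-heavy : ∀ t j H Z → H ++ Z ↭ allFin n → length H + j ≡ t → ¬ Family (suc j) H →
    (∀ H Z → H ++ Z ↭ allFin n → length H ≡ t → Hits H → ⊥) →
    (∀ j H Z → H ++ Z ↭ allFin n → length H + suc j ≡ t → ¬ Family (2 + j) H → All (Light (t * L) H) Z → ⊥) →
    ⊥
  peel-heavy t zero H Z perm len none k₁ k₂ =
    k₁ H Z perm (≡.trans (≡.sym (+-identityʳ _)) len) λ c cyc c∉ →
      none (Family-∷ c cyc c∉ ((λ ()) , (λ ()) , (λ ()) , λ ()) λ ())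
  peel-heavy t (suc j) H Z perm len none k₁ k₂ = light-or-heavy Z (k₂ j H Z perm len none) step-heavy
    where
    step-heavy : ∀ v → v ∈ Z → ¬ Light (t * L) H v → ⊥
    step-heavy v v∈ heavy with ∈⇒↭ v∈
    ... | Z′ , p = peel-heavy t j (v ∷ H) Z′
      (↭-trans (↭-sym (shift v H Z′)) (↭-trans (++⁺ˡ H (↭-sym p)) perm))
      (≡.trans (≡.sym (+-suc (length H) j)) len)
      (heavy-step heavy (*-monoˡ-≤ L (≤-trans (m≤n+m (suc j) (length H)) (≤-reflexive len))) none)
      k₁ k₂

  -- Positions in `Z` serve as the vertices of the induced subgraph, to which `kr≤ex` applies.
  K≤ex : ∀ {m i x} Z → Unique Z → length Z ≤ m → (∀ c → IsCycle c → ¬ (∀ j → c j ∈ Z)) →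
    IsEx m i L x → K (adj G) i Z ≤ x
  K≤ex {m} {i} {x} Z u len none isEx = begin
    K (adj G) i Z                                   ≡⟨ cong (K (adj G) i) (≡.trans (map-tabulate id (lookup Z)) (tabulate-lookup Z)) ⟨
    K (adj G) i (map (lookup Z) (allFin (length Z)))  ≡⟨ K-map (adj G) (lookup Z) i _ ⟩
    K (adj H) i (allFin (length Z))                 ≡⟨ kr≡K i H ⟨
    kr i H                                          ≤⟨ kr≤ex isEx (m ∸ length Z) (m∸n+n≡m len) H free ⟩
    x                                               ∎
    where
    open ≤-Reasoning
    H : Graph (length Z)
    H = pull (lookup Z) G
    free : ¬ HasCycle L H
    free (c , inj , edge) = none (lookup Z ∘ c zero)
      ((λ a b eq → proj₂ (inj zero zero a b (lookup-injective u _ _ eq))) , edge zero)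
      (λ j → ∈-lookup {xs = Z} (c zero j))

disjointʳ : ∀ {A : Set} (xs : List A) {ys} → Unique (xs ++ ys) → ∀ {x} → x ∈ ys → x ∉ xs
disjointʳ (x ∷ xs) (x∉ ∷ u) z∈ (here refl) = All.lookup x∉ (∈-++⁺ʳ xs z∈) refl
disjointʳ (x ∷ xs) (x∉ ∷ u) z∈ (there z∈′) = disjointʳ xs u z∈ z∈′

Unique-++⁻ʳ : ∀ {A : Set} (xs : List A) {ys} → Unique (xs ++ ys) → Unique ys
Unique-++⁻ʳ []       u       = u
Unique-++⁻ʳ (x ∷ xs) (_ ∷ u) = Unique-++⁻ʳ xs u

module _ {n : ℕ} (G : Graph n) (l : ℕ) where

  open DecMembership (_≟_ {n}) using (_∈?_)

  -- Neighbours of `v` outside `B` contain no path on `2 + l` vertices, since `v` would close it to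
  -- a cycle avoiding `B` and `H`; so `K-pathFree` applies there. The at most `M` neighbours in `B`
  -- cost a factor `2 ^ M`.
  K-light : ∀ {M H Z v} → Unique Z → (∀ {x} → x ∈ Z → x ∉ H) → v ∈ Z → length Z ≤ n → Light G (3 + l) M H v →
    ∀ i → K (adj G) i (nbrs (adj G) v Z) ≤ 2 ^ M * (2 ^ suc l * suc n)
  K-light {M} {H} {Z} {v} u Z∉H v∈Z lenZ (B , lenB , v∉B , none) i = begin
    K (adj G) i Y                             ≡⟨ K-↭ (adj G) (sym G) i (filter-split (_∈? B) Y) ⟩
    K (adj G) i (P ++ Q)                      ≤⟨ K-++≤joinCount (adj G) i P Q ⟩
    joinCount (length P) i (λ j → K (adj G) j Q) ≤⟨ joinCount≤const (length P) i _ (λ j → K-pathFree (adj G) (sym G) (suc l) j Q uQ noPath) ⟩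
    2 ^ length P * (2 ^ suc l * suc (length Q))  ≤⟨ *-mono-≤ (^-monoʳ-≤ 2 (≤-trans lenP lenB)) (*-monoʳ-≤ (2 ^ suc l) (s≤s lenQ)) ⟩
    2 ^ M * (2 ^ suc l * suc n)               ∎
    where
    open ≤-Reasoning
    Y P Q : List (Fin n)
    Y = nbrs (adj G) v Z
    P = filter (_∈? B) Y
    Q = filter (¬? ∘ (_∈? B)) Y
    uY : Unique Y
    uY = Unique-filter⁺ (T? ∘ adj G v) u
    uQ : Unique Q
    uQ = Unique-filter⁺ (¬? ∘ (_∈? B)) uY
    lenP : length P ≤ length B
    lenP = Unique⇒length≤ (Unique-filter⁺ (_∈? B) uY) (λ x∈ → proj₂ (∈-filter⁻ (_∈? B) {xs = Y} x∈))
    lenQ : length Q ≤ n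
    lenQ = ≤-trans (length-filter (¬? ∘ (_∈? B)) Y) (≤-trans (length-filter (T? ∘ adj G v) Z) lenZ)
    ∈Q : ∀ {x} → x ∈ Q → x ∈ Z × T (adj G v x) × x ∉ B
    ∈Q x∈ with ∈-filter⁻ (¬? ∘ (_∈? B)) {xs = Y} x∈
    ... | x∈Y , x∉B with ∈-filter⁻ (T? ∘ adj G v) {xs = Z} x∈Y
    ...   | x∈Z , vx = x∈Z , vx , x∉B
    noPath : NoPath (adj G) (sym G) (2 + l) Q
    noPath ps len ups link sub with path⇒cycle G (3 + l) v ps (cong suc len) (s≤s (s≤s z≤n)) (All.tabulate v∉ps ∷ ups) link
                                      (λ x∈ → proj₁ (proj₂ (∈Q (sub x∈))))
      where
      v∉ps : ∀ {x} → x ∈ ps → v ≢ x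
      v∉ps x∈ refl = subst T (irrefl G v) (proj₁ (proj₂ (∈Q (sub x∈))))
    ... | c , cyc , c∈ , i , ci≡v = none c cyc (λ j → avoidB (c∈ j)) (λ j → avoidH (c∈ j)) i ci≡v
      where
      avoidB : ∀ {x} → x ∈ v ∷ ps → x ∉ B
      avoidB (here refl) = v∉B
      avoidB (there x∈)  = proj₂ (proj₂ (∈Q (sub x∈)))
      avoidH : ∀ {x} → x ∈ v ∷ ps → x ∉ H
      avoidH (here refl) = Z∉H v∈Z
      avoidH (there x∈)  = Z∉H (proj₁ (∈Q (sub x∈)))

-- The two bounds

module _ (l t r m : ℕ) (ex : ℕ → ℕ) (isEx : ∀ i → i ≤ r → IsEx m i (3 + l) (ex i)) (G : Graph (t + m)) where

  private
    n L : ℕ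
    n = t + m
    L = 3 + l

  open DecMembership (_≟_ {n}) using (_∈?_)

  -- At most `t * L` vertices hit the cycles and `t` more are discarded; the other factor is the
  -- bound of `K-light` for each of them.
  error : ℕ
  error = (t * L + t) * (2 ^ (t * L) * (2 ^ suc l * suc n))

  -- Removing the light vertices of `A` from `Z` loses only `error` cliques and leaves a set without
  -- cycles, small enough to be compared with `ex i`.
  few-heavy : ∀ H Z B → H ++ Z ↭ allFin n → All (Light G L (t * L) H) Z → length B ≤ t * L → Hits G L (B ++ H) →
    ∀ i → i ≤ r → K (adj G) i Z ≤ ex i + error
  few-heavy H Z B perm light lenB hits i i≤r = begin
    K (adj G) i Z                       ≡⟨ K-↭ (adj G) (sym G) i Z↭ ⟩
    K (adj G) i (A ++ Z₂)               ≤⟨ K-++≤+ (adj G) i X A Z₂ ⊆-refl small ⟩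
    K (adj G) i Z₂ + length A * X       ≤⟨ +-mono-≤ (K≤ex G L Z₂ uZ₂ lenZ₂ free (isEx i i≤r)) (*-monoˡ-≤ X lenA) ⟩
    ex i + error                        ∎
    where
    open ≤-Reasoning
    X : ℕ
    X = 2 ^ (t * L) * (2 ^ suc l * suc n)
    A₁ Z₁ A Z₂ : List (Fin n)
    A₁ = filter (_∈? B) Z
    Z₁ = filter (¬? ∘ (_∈? B)) Z
    -- Besides the hitting set, `t` further vertices are dropped: `H` may have fewer than `t`
    -- elements, and `Z₂` has to fit into `m` vertices.
    A  = A₁ ++ take t Z₁
    Z₂ = drop t Z₁
    Z↭ : Z ↭ A ++ Z₂
    Z↭ = ↭-trans (filter-split (_∈? B) Z)
      (↭-reflexive (≡.trans (cong (A₁ ++_) (≡.sym (take++drop≡id t Z₁))) (≡.sym (++-assoc A₁ (take t Z₁) Z₂))))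
    uHZ : Unique (H ++ Z)
    uHZ = Unique-resp-↭ (↭-sym perm) (allFin⁺ n)
    uZ : Unique Z
    uZ = Unique-++⁻ʳ H uHZ
    uZ₂ : Unique Z₂
    uZ₂ = drop⁺ t (Unique-filter⁺ (¬? ∘ (_∈? B)) uZ)
    lenZ : length Z ≤ n
    lenZ = ≤-trans (m≤n+m (length Z) (length H))
      (≤-reflexive (≡.trans (≡.sym (length-++ H)) (≡.trans (↭-length perm) (length-allFin n))))
    lenZ₂ : length Z₂ ≤ m
    lenZ₂ = begin
      length Z₂      ≡⟨ length-drop t Z₁ ⟩
      length Z₁ ∸ t  ≤⟨ ∸-monoˡ-≤ t (≤-trans (length-filter (¬? ∘ (_∈? B)) Z) lenZ) ⟩
      n ∸ t          ≡⟨ m+n∸m≡n t m ⟩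
      m              ∎
    lenA : length A ≤ t * L + t
    lenA = begin
      length A                         ≡⟨ length-++ A₁ ⟩
      length A₁ + length (take t Z₁)   ≤⟨ +-mono-≤
        (≤-trans (Unique⇒length≤ (Unique-filter⁺ (_∈? B) uZ) (λ x∈ → proj₂ (∈-filter⁻ (_∈? B) {xs = Z} x∈))) lenB)
        (≤-trans (≤-reflexive (length-take t Z₁)) (m⊓n≤m t _)) ⟩
      t * L + t ∎
    small : ∀ {a} → a ∈ A → ∀ i → K (adj G) i (nbrs (adj G) a (A ++ Z₂)) ≤ X
    small {a} a∈ i = ≤-trans
      (≤-reflexive (K-↭ (adj G) (sym G) i (filter-↭ (T? ∘ adj G a) (↭-sym Z↭))))
      (K-light G l uZ (disjointʳ H uHZ) a∈Z lenZ (All.lookup light a∈Z) i)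
      where
      a∈Z : a ∈ Z
      a∈Z = ∈-resp-↭ (↭-sym Z↭) (∈-++⁺ˡ a∈)
    free : ∀ c → IsCycle G L c → ¬ (∀ j → c j ∈ Z₂)
    free c cyc c∈ = hits c cyc λ j → avoid (∈-filter⁻ (¬? ∘ (_∈? B)) {xs = Z} (Any-resp-⊆ (drop-⊆ t Z₁) (c∈ j)))
      where
      avoid : ∀ {x} → x ∈ Z × x ∉ B → x ∉ B ++ H
      avoid (x∈Z , x∉B) x∈ with ∈-++⁻ B x∈
      ... | inj₁ x∈B = x∉B x∈B
      ... | inj₂ x∈H = disjointʳ H uHZ x∈Z x∈H

  upper-bound : 3 ≤ r → r ≤ t → 2 ^ t * error ≤ ex 2 → ¬ HasDisjointCycles (suc t) L G → kr r G ≤ joinCount t r ex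
  upper-bound 3≤r r≤t big none = decidable-stable (kr r G ≤? joinCount t r ex) λ ≰ →
    peel-heavy G L t t [] (allFin n) ↭-refl refl (λ { (c , inj , edge , _) → none (c , inj , edge) })
      (λ H Z perm len hits → ≰ (all-heavy H Z perm len hits))
      (λ j H Z perm len no-family light → hitting-set G L (suc j) H no-family λ B lenB hits →
        ≰ (≤-trans (split H Z perm) (gain (length H) (≤-trans (s≤s (m≤m+n (length H) j)) (≤-reflexive (≡.trans (≡.sym (+-suc (length H) j)) len)))
          (few-heavy H Z B perm light (≤-trans lenB (*-monoˡ-≤ L (≤-trans (m≤n+m (suc j) (length H)) (≤-reflexive len)))) hits))))
    where
    open ≤-Reasoning
    split : ∀ H Z → H ++ Z ↭ allFin n → kr r G ≤ joinCount (length H) r (λ i → K (adj G) i Z)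
    split H Z perm = ≤-trans (≤-reflexive (≡.trans (kr≡K r G) (K-↭ (adj G) (sym G) r (↭-sym perm))))
      (K-++≤joinCount (adj G) r H Z)

    all-heavy : ∀ H Z → H ++ Z ↭ allFin n → length H ≡ t → Hits G L H → kr r G ≤ joinCount t r ex
    all-heavy H Z perm len hits = ≤-trans (split H Z perm) (subst (λ h → joinCount h r _ ≤ joinCount t r ex) (≡.sym len) (joinCount-mono t r λ i i≤r →
      K≤ex G L Z (Unique-++⁻ʳ H uHZ) lenZ (λ c cyc c∈ → hits c cyc λ j → disjointʳ H uHZ (c∈ j)) (isEx i i≤r)))
      where
      uHZ : Unique (H ++ Z)
      uHZ = Unique-resp-↭ (↭-sym perm) (allFin⁺ n)
      lenZ : length Z ≤ m
      lenZ = ≤-reflexive (+-cancelˡ-≡ t _ _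
        (≡.trans (cong (_+ length Z) (≡.sym len)) (≡.trans (≡.sym (length-++ H)) (≡.trans (↭-length perm) (length-allFin n)))))

    -- The total error is at most `2 ^ h * error`, and one more joined vertex already gains the term
    -- `ex 2`, which exceeds it by `big`.
    gain : ∀ h {f : ℕ → ℕ} → h < t → (∀ i → i ≤ r → f i ≤ ex i + error) → joinCount h r f ≤ joinCount t r ex
    gain h {f} h<t f≤ = begin
      joinCount h r f                       ≤⟨ joinCount-mono h r f≤ ⟩
      joinCount h r (λ i → ex i + error)    ≤⟨ joinCount-+const h r ex error ⟩
      joinCount h r ex + 2 ^ h * error      ≤⟨ +-monoʳ-≤ (joinCount h r ex) (≤-trans (*-monoˡ-≤ error (^-monoʳ-≤ 2 (<⇒≤ h<t))) big) ⟩
      joinCount h r ex + ex 2               ≤⟨ last h<t 3≤r r≤t ⟩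
      joinCount t r ex                      ∎
      where
      -- Pascal's rule splits the right side: the first part dominates the count for `h`, and the
      -- second contains `ex 2` because the clique size, lowered by one, is still at least 2.
      last : ∀ {t r} → h < t → 3 ≤ r → r ≤ t → joinCount h r ex + ex 2 ≤ joinCount t r ex
      last {suc t} {suc r} (s≤s h≤t) (s≤s 2≤r) (s≤s r≤t) =
        +-mono-≤ (joinCount-monoˡ (suc r) ex h≤t) (term≤joinCount t r 2 ex 2≤r (≤-trans r≤t (m≤n+m t 2)))

-- The threshold for n.

module _ (l t : ℕ) where

  private
    -- The coefficient of `suc n` in `2 ^ t * error`.
    factor : ℕ
    factor = 2 ^ t * ((t * (3 + l) + t) * (2 ^ (t * (3 + l)) * 2 ^ suc l))

  threshold : ℕ
  threshold = 2 * factor * suc t + stubBound l (suc (2 * factor))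

  -- The dense construction is used with degree `suc (2 * factor)`: the part `2 * factor` matches
  -- the required slope, and the extra `m` absorbs all constants once it reaches `threshold`.
  ex₂-large : ∀ m → threshold ≤ m → ∀ x → IsEx m 2 (3 + l) x →
    2 ^ t * ((t * (3 + l) + t) * (2 ^ (t * (3 + l)) * (2 ^ suc l * suc (t + m)))) ≤ x
  ex₂-large m large x isEx with dense-free-graph l (suc (2 * factor)) m
  ... | G , free , dense = ≤-trans (≤-reflexive (assoc (2 ^ t) (t * (3 + l) + t) (2 ^ (t * (3 + l))) (2 ^ suc l) (suc (t + m))))
    (≤-trans (*-cancelˡ-≤ 2 (+-cancelʳ-≤ bound _ _ twice)) (proj₂ isEx G free))
    where
    open ≤-Reasoning
    bound : ℕ
    bound = stubBound l (suc (2 * factor))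
    assoc : ∀ a b c d z → a * (b * (c * (d * z))) ≡ a * (b * (c * d)) * z
    assoc = solve-∀
    expand : ∀ f t m b → 2 * (f * suc (t + m)) + b ≡ 2 * f * suc t + b + 2 * f * m
    expand = solve-∀
    twice : 2 * (factor * suc (t + m)) + bound ≤ 2 * kr 2 G + bound
    twice = begin
      2 * (factor * suc (t + m)) + bound          ≡⟨ expand factor t m bound ⟩
      threshold + 2 * factor * m                  ≤⟨ +-monoˡ-≤ (2 * factor * m) large ⟩
      m + 2 * factor * m                          ≤⟨ dense ⟩
      2 * kr 2 G + bound                          ∎

private
  -- The shapes `3 + l`, `t + m` and `suc t` enter as equations, so that matching on `refl` replaces
  -- transport along them.
  both-bounds : ∀ {L n s} l t r m → L ≡ 3 + l → n ≡ t + m → s ≡ suc t → r ≥ 3 → t ≥ r → threshold l t ≤ m →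
    (ex : ℕ → ℕ) → (∀ i → i ≤ r → IsEx m i L (ex i)) →
    ((G : Graph n) → ¬ HasDisjointCycles s L G → kr r G ≤ sumTo r (λ i → (t C (r ∸ i)) * ex i))
    ×
    (Σ (Graph n) λ G → ¬ HasDisjointCycles s L G ×
      (t C r) + (t C (r ∸ 1)) * m + max2To r (λ s → (t C (r ∸ s)) * ex s) ≤ kr r G)
  both-bounds l t r m refl refl refl r≥3 t≥r large ex isEx =
    (λ G none → ≤-trans
      (upper-bound l t r m ex isEx G r≥3 t≥r (ex₂-large l t m large (ex 2) (isEx 2 (≤-trans (n≤1+n 2) r≥3))) none)
      (≤-reflexive (≡.sym (sumTo≡joinCount t r ex)))) ,
    lower-bound (3 + l) t r m r≥3 ex isEx

theorem1p2 : (k t r : ℕ) → k ≥ 2 → r ≥ 3 → t ≥ r →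
    Σ ℕ λ N → (n : ℕ) → n ≥ N → (ex : ℕ → ℕ) →
    (∀ i → i ≤ r → IsEx (n ∸ t) i (2 * k) (ex i)) →
    ((G : Graph n) → ¬ HasDisjointCycles (t + 1) (2 * k) G →
    kr r G ≤ sumTo r (λ i → (t C (r ∸ i)) * ex i))
    ×
    (Σ (Graph n) λ G → ¬ HasDisjointCycles (t + 1) (2 * k) G ×
    (t C r) + (t C (r ∸ 1)) * (n ∸ t) + max2To r (λ s → (t C (r ∸ s)) * ex s) ≤ kr r G)
-- Since `2 * k` is at least 4, subtracting 3 is exact; the summand `t` in the bound makes `n ∸ t`
-- exact and at least `threshold`.
theorem1p2 k t r k≥2 r≥3 t≥r = t + threshold (2 * k ∸ 3) t , λ n n≥N →
  both-bounds (2 * k ∸ 3) t r (n ∸ t)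
    (≡.sym (m+[n∸m]≡n (≤-trans (n≤1+n 3) (*-monoʳ-≤ 2 k≥2))))
    (≡.sym (m+[n∸m]≡n (≤-trans (m≤m+n t _) n≥N)))
    (+-comm t 1) r≥3 t≥r
    (≤-trans (≤-reflexive (≡.sym (m+n∸m≡n t _))) (∸-monoˡ-≤ t n≥N))
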